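{- Let $G_1$ and $G_2$ be graphs with a common vertex set $V$ (of size $n$), let $\{V_1,\dots,V_m\}$ be a partition of $V$, and suppose there is a unital $C^*$-algebra $\mathcal{A}$ and a quantum permutation matrix $u\in M_n(\mathcal{A})$ with $uA_{G_1}=A_{G_2}u$ that is block diagonal with respect to $\{V_1,\dots,V_m\}$, i.e. $u_{ab}=0$ whenever $a$ and $b$ lie in different parts. Let $\{S_1,\dots,S_{k+1}\}$ be a partition of $\{1,\dots,m\}$ and define the partition $\pi=\{C_1,\dots,C_k,D\}$ of $V$ by $C_i:=\bigcup_{s\in S_i}V_s$ ($1\le i\le k$) and $D:=\bigcup_{s\in S_{k+1}}V_s$. If both $G_1$ and $G_2$ satisfy the Godsil–McKay conditions (i) and (ii) with respect to $\pi$, then the switched graphs $G_1^{\pi,D}$ and $G_2^{\pi,D}$ are quantum isomorphic.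
   Context: A quantum permutation matrix over a unital $C^*$-algebra $\mathcal{A}$ is $u=(u_{ij})\in M_n(\mathcal{A})$ with $u_{ij}=u_{ij}^*=u_{ij}^2$ and $\sum_ku_{ik}=1=\sum_ku_{ki}$ for all $i$. Graphs $G_1,G_2$ on $n$ vertices are quantum isomorphic if there is a unital $C^*$-algebra $\mathcal{A}$ and a quantum permutation matrix $u\in M_n(\mathcal{A})$ with $A_{G_1}u=uA_{G_2}$, where $A_G$ is the adjacency matrix. Godsil–McKay switching: given a graph $G$ and a partition $\pi=\{C_1,\dots,C_k,D\}$ of $V(G)$ with $n_i=|C_i|$, the conditions are (i) for all $1\le i,j\le k$, any two vertices in $C_i$ have the same number of neighbours in $C_j$; (ii) each $v\in D$ has either $0$, $n_i/2$ or $n_i$ neighbours in $C_i$, for each $i$. The graph $G^{\pi,D}$ is obtained by, for each $v\in D$ and each $i$ such that $v$ has exactly $n_i/2$ neighbours in $C_i$, deleting these $n_i/2$ edges and joining $v$ instead to the other $n_i/2$ vertices of $C_i$. -}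

module Defs where

open import Algebra.Bundles using (CommutativeRing; Ring)
open import Algebra.Module.Structures using (IsLeftModule)
open import Algebra.Structures using (IsCommutativeRing; IsRing)
import Algebra.Properties.Monoid.Sum as MonoidSum
open import Data.Bool.Base using (Bool; true; false; not; if_then_else_; _∧_; _∨_)
open import Data.Bool.Properties using (∨-comm)
open import Data.Fin.Base using (Fin; fromℕ; inject₁)
import Data.Fin.Properties as Fin
open import Data.Fin.Subset using (Subset; ∣_∣; _∩_)
open import Data.Nat.Base as ℕ using (ℕ; suc)
import Data.Nat.Properties as ℕ
open import Data.Product.Base using (Σ; ∃; _×_; _,_; proj₁; proj₂)
open import Data.Rational.Base as ℚ using (ℚ; 0ℚ; 1ℚ; ½)
import Data.Rational.Properties as ℚ
open import Data.Rational.Solver using (module +-*-Solver)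
open import Data.Sum.Base using (_⊎_)
open import Data.Vec.Base using (tabulate)
open import Function.Bundles using (_⇔_; mk⇔)
open import Function.Definitions using (StrictlySurjective)
open import Level using (Level; _⊔_) renaming (suc to lsuc)
open import Relation.Binary.Core using (Rel)
open import Relation.Binary.PropositionalEquality using (_≡_; _≢_; refl; sym; trans; cong; cong₂; subst)
open import Relation.Binary.Structures using (IsEquivalence)
open import Relation.Nullary using (¬_)
open import Relation.Nullary.Decidable using (⌊_⌋; yes; no)

------------------------------------------------------------------------
-- Real numbers: Cauchy sequences of rationals, carrying their modulus of
-- convergence, up to the equivalence "the difference tends to 0".

Cauchy : (ℕ → ℚ) → Set
Cauchy x = ∀ ε → 0ℚ ℚ.< ε → ∃ λ N → ∀ m n → N ℕ.≤ m → N ℕ.≤ n → ℚ.∣ x m ℚ.- x n ∣ ℚ.< ε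

record ℝ : Set where
  constructor mkℝ
  field
    seq    : ℕ → ℚ
    cauchy : Cauchy seq

open ℝ public

infix 4 _≃ℝ_ _≤ℝ_

_≃ℝ_ : Rel ℝ _
x ≃ℝ y = ∀ ε → 0ℚ ℚ.< ε → ∃ λ N → ∀ n → N ℕ.≤ n → ℚ.∣ seq x n ℚ.- seq y n ∣ ℚ.< ε

_≤ℝ_ : Rel ℝ _
x ≤ℝ y = ∀ ε → 0ℚ ℚ.< ε → ∃ λ N → ∀ n → N ℕ.≤ n → seq x n ℚ.≤ seq y n ℚ.+ ε

-- Families of rationals that become arbitrarily small.  The two instances
-- below (indices ℕ × ℕ and ℕ) serve the Cauchy condition and _≃ℝ_.
private
  module Vanishing (I : Set) (_≽_ : I → ℕ → Set)
                   (≽-down : ∀ {i M N} → M ℕ.≤ N → i ≽ N → i ≽ M) where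

    Small : (I → ℚ) → Set
    Small z = ∀ ε → 0ℚ ℚ.< ε → ∃ λ N → ∀ i → i ≽ N → ℚ.∣ z i ∣ ℚ.< ε

    Bounded : (I → ℚ) → Set
    Bounded z = ∃ λ K → 0ℚ ℚ.< K × ∃ λ N → ∀ i → i ≽ N → ℚ.∣ z i ∣ ℚ.≤ K

    small-cong : ∀ {y z} → (∀ i → y i ≡ z i) → Small y → Small z
    small-cong eq s ε ε>0 with s ε ε>0
    ... | N , b = N , λ i i≽N → subst (λ q → ℚ.∣ q ∣ ℚ.< ε) (eq i) (b i i≽N)

    small-0 : ∀ {z} → (∀ i → z i ≡ 0ℚ) → Small z
    small-0 eq ε ε>0 = 0 , λ i _ → subst (λ q → ℚ.∣ q ∣ ℚ.< ε) (sym (eq i)) ε>0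

    small-neg : ∀ {z} → Small z → Small (λ i → ℚ.- z i)
    small-neg {z} s ε ε>0 with s ε ε>0
    ... | N , b = N , λ i i≽N → subst (ℚ._< ε) (sym (ℚ.∣-p∣≡∣p∣ (z i))) (b i i≽N)

    small-+ : ∀ {y z} → Small y → Small z → Small (λ i → y i ℚ.+ z i)
    small-+ {y} {z} s t ε ε>0 with s (½ ℚ.* ε) ½ε>0 | t (½ ℚ.* ε) ½ε>0
      where
      ½ε>0 : 0ℚ ℚ.< ½ ℚ.* ε
      ½ε>0 = subst (ℚ._< ½ ℚ.* ε) (ℚ.*-zeroʳ ½) (ℚ.*-monoʳ-<-pos ½ ε>0)
    ... | M , b | N , c = M ℕ.⊔ N , λ i i≽ →
      ℚ.≤-<-trans (ℚ.∣p+q∣≤∣p∣+∣q∣ (y i) (z i))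
        (subst (ℚ.∣ y i ∣ ℚ.+ ℚ.∣ z i ∣ ℚ.<_) halves
          (ℚ.+-mono-< (b i (≽-down (ℕ.m≤m⊔n M N) i≽)) (c i (≽-down (ℕ.m≤n⊔m M N) i≽))))
      where
      halves : ½ ℚ.* ε ℚ.+ ½ ℚ.* ε ≡ ε
      halves = trans (sym (ℚ.*-distribʳ-+ ε ½ ½)) (ℚ.*-identityˡ ε)

    small-* : ∀ {y z} → Bounded y → Small z → Small (λ i → y i ℚ.* z i)
    small-* {y} {z} (K , K>0 , M , b) s ε ε>0 = M ℕ.⊔ N , λ i i≽ →
      subst (ℚ._< ε) (sym (ℚ.∣p*q∣≡∣p∣*∣q∣ (y i) (z i)))
        (ℚ.≤-<-trans
          (ℚ.*-monoʳ-≤-nonNeg ℚ.∣ z i ∣ {{ℚ.nonNegative (ℚ.0≤∣p∣ (z i))}}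
            (b i (≽-down (ℕ.m≤m⊔n M N) i≽)))
          (subst (K ℚ.* ℚ.∣ z i ∣ ℚ.<_) K*δ≡ε
            (ℚ.*-monoʳ-<-pos K (c i (≽-down (ℕ.m≤n⊔m M N) i≽)))))
      where
      instance
        K-pos : ℚ.Positive K
        K-pos = ℚ.positive K>0
        K-nonZero : ℚ.NonZero K
        K-nonZero = ℚ.pos⇒nonZero K
        1/K-pos : ℚ.Positive (ℚ.1/ K)
        1/K-pos = ℚ.1/pos⇒pos K
      δ : ℚ
      δ = ℚ.1/ K ℚ.* ε
      δ>0 : 0ℚ ℚ.< δ
      δ>0 = subst (ℚ._< δ) (ℚ.*-zeroʳ (ℚ.1/ K)) (ℚ.*-monoʳ-<-pos (ℚ.1/ K) ε>0)
      K*δ≡ε : K ℚ.* δ ≡ ε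
      K*δ≡ε = trans (sym (ℚ.*-assoc K (ℚ.1/ K) ε))
        (trans (cong (ℚ._* ε) (ℚ.*-inverseʳ K)) (ℚ.*-identityˡ ε))
      N = proj₁ (s δ δ>0)
      c = proj₂ (s δ δ>0)

  module V₁ = Vanishing ℕ (λ n N → N ℕ.≤ n) ℕ.≤-trans
  module V₂ = Vanishing (ℕ × ℕ) (λ (m , n) N → N ℕ.≤ m × N ℕ.≤ n)
                (λ M≤N (p , q) → ℕ.≤-trans M≤N p , ℕ.≤-trans M≤N q)

  gap : (ℕ → ℚ) → ℕ × ℕ → ℚ
  gap x (m , n) = x m ℚ.- x n

  toSmall : (x : ℝ) → V₂.Small (gap (seq x))
  toSmall x ε ε>0 = let (N , b) = cauchy x ε ε>0 in N , λ (m , n) (p , q) → b m n p q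

  fromSmall : (x : ℕ → ℚ) → V₂.Small (gap x) → Cauchy x
  fromSmall x s ε ε>0 = let (N , b) = s ε ε>0 in N , λ m n p q → b (m , n) (p , q)

  seq-bounded : (x : ℝ) → V₁.Bounded (seq x)
  seq-bounded x with cauchy x 1ℚ (ℚ.positive⁻¹ 1ℚ)
  ... | N , b = K , K>0 , N , bound
    where
    K : ℚ
    K = 1ℚ ℚ.+ ℚ.∣ seq x N ∣
    K>0 : 0ℚ ℚ.< K
    K>0 = ℚ.+-mono-<-≤ (ℚ.positive⁻¹ 1ℚ) (ℚ.0≤∣p∣ (seq x N))
    split : ∀ p q → (p ℚ.- q) ℚ.+ q ≡ p
    split = solve 2 (λ p q → (p :- q) :+ q := p) refl where open +-*-Solver
    bound : ∀ n → N ℕ.≤ n → ℚ.∣ seq x n ∣ ℚ.≤ K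
    bound n N≤n = subst (λ q → ℚ.∣ q ∣ ℚ.≤ K) (split (seq x n) (seq x N))
      (ℚ.≤-trans (ℚ.∣p+q∣≤∣p∣+∣q∣ (seq x n ℚ.- seq x N) (seq x N))
        (ℚ.+-monoˡ-≤ ℚ.∣ seq x N ∣ (ℚ.<⇒≤ (b n N N≤n ℕ.≤-refl))))

  bounded-fst : ∀ {z} → V₁.Bounded z → V₂.Bounded (λ (m , n) → z m)
  bounded-fst (K , K>0 , N , b) = K , K>0 , N , λ (m , n) (p , q) → b m p

  bounded-snd : ∀ {z} → V₁.Bounded z → V₂.Bounded (λ (m , n) → z n)
  bounded-snd (K , K>0 , N , b) = K , K>0 , N , λ (m , n) (p , q) → b n q

  +-gap : ∀ a b c d → (a ℚ.- c) ℚ.+ (b ℚ.- d) ≡ (a ℚ.+ b) ℚ.- (c ℚ.+ d)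
  +-gap = solve 4 (λ a b c d → (a :- c) :+ (b :- d) := (a :+ b) :- (c :+ d)) refl
    where open +-*-Solver

  *-gap : ∀ a b c d → a ℚ.* (b ℚ.- d) ℚ.+ d ℚ.* (a ℚ.- c) ≡ a ℚ.* b ℚ.- c ℚ.* d
  *-gap = solve 4 (λ a b c d → a :* (b :- d) :+ d :* (a :- c) := a :* b :- c :* d) refl
    where open +-*-Solver

  neg-gap : ∀ a c → ℚ.- (a ℚ.- c) ≡ (ℚ.- a) ℚ.- (ℚ.- c)
  neg-gap = solve 2 (λ a c → :- (a :- c) := (:- a) :- (:- c)) refl
    where open +-*-Solver

-- Closure of the Cauchy condition; abstract so that proof terms never unfold.
abstract
  cauchy-const : ∀ q → Cauchy (λ _ → q)
  cauchy-const q = fromSmall (λ _ → q) (V₂.small-0 (λ _ → ℚ.+-inverseʳ q))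

  cauchy-+ : ∀ x y → Cauchy (λ n → seq x n ℚ.+ seq y n)
  cauchy-+ x y = fromSmall (λ n → seq x n ℚ.+ seq y n)
    (V₂.small-cong (λ (m , n) → +-gap (seq x m) (seq y m) (seq x n) (seq y n))
      (V₂.small-+ (toSmall x) (toSmall y)))

  cauchy-* : ∀ x y → Cauchy (λ n → seq x n ℚ.* seq y n)
  cauchy-* x y = fromSmall (λ n → seq x n ℚ.* seq y n)
    (V₂.small-cong (λ (m , n) → *-gap (seq x m) (seq y m) (seq x n) (seq y n))
      (V₂.small-+ (V₂.small-* (bounded-fst (seq-bounded x)) (toSmall y))
                  (V₂.small-* (bounded-snd (seq-bounded y)) (toSmall x))))

  cauchy-neg : ∀ x → Cauchy (λ n → ℚ.- seq x n)
  cauchy-neg x = fromSmall (λ n → ℚ.- seq x n)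
    (V₂.small-cong (λ (m , n) → neg-gap (seq x m) (seq x n))
      (V₂.small-neg (toSmall x)))

fromℚ : ℚ → ℝ
fromℚ q = mkℝ (λ _ → q) (cauchy-const q)

0ℝ 1ℝ : ℝ
0ℝ = fromℚ 0ℚ
1ℝ = fromℚ 1ℚ

infixl 6 _+ℝ_
infixl 7 _*ℝ_
infix  8 -ℝ_

_+ℝ_ : ℝ → ℝ → ℝ
x +ℝ y = mkℝ (λ n → seq x n ℚ.+ seq y n) (cauchy-+ x y)

_*ℝ_ : ℝ → ℝ → ℝ
x *ℝ y = mkℝ (λ n → seq x n ℚ.* seq y n) (cauchy-* x y)

-ℝ_ : ℝ → ℝ
-ℝ x = mkℝ (λ n → ℚ.- seq x n) (cauchy-neg x)

pointwise : ∀ {x y} → (∀ n → seq x n ≡ seq y n) → x ≃ℝ y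
pointwise {x} {y} eq = V₁.small-0
  (λ n → trans (cong (ℚ._- seq y n) (eq n)) (ℚ.+-inverseʳ (seq y n)))

≃ℝ-refl : ∀ {x} → x ≃ℝ x
≃ℝ-refl {x} = pointwise {x} {x} (λ _ → refl)

≃ℝ-sym : ∀ {x y} → x ≃ℝ y → y ≃ℝ x
≃ℝ-sym {x} {y} p = V₁.small-cong (λ n → flip-gap (seq x n) (seq y n)) (V₁.small-neg p)
  where
  open +-*-Solver
  flip-gap : ∀ a b → ℚ.- (a ℚ.- b) ≡ b ℚ.- a
  flip-gap = solve 2 (λ a b → :- (a :- b) := b :- a) refl

≃ℝ-trans : ∀ {x y z} → x ≃ℝ y → y ≃ℝ z → x ≃ℝ z
≃ℝ-trans {x} {y} {z} p q =
  V₁.small-cong (λ n → chain (seq x n) (seq y n) (seq z n)) (V₁.small-+ p q)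
  where
  open +-*-Solver
  chain : ∀ a b c → (a ℚ.- b) ℚ.+ (b ℚ.- c) ≡ a ℚ.- c
  chain = solve 3 (λ a b c → (a :- b) :+ (b :- c) := a :- c) refl

≃ℝ-isEquivalence : IsEquivalence _≃ℝ_
≃ℝ-isEquivalence = record
  { refl  = λ {x} → ≃ℝ-refl {x}
  ; sym   = λ {x} {y} → ≃ℝ-sym {x} {y}
  ; trans = λ {x} {y} {z} → ≃ℝ-trans {x} {y} {z}
  }

+ℝ-cong : ∀ {x y z w} → x ≃ℝ y → z ≃ℝ w → x +ℝ z ≃ℝ y +ℝ w
+ℝ-cong {x} {y} {z} {w} p q =
  V₁.small-cong (λ n → +-gap (seq x n) (seq z n) (seq y n) (seq w n)) (V₁.small-+ p q)

*ℝ-cong : ∀ {x y z w} → x ≃ℝ y → z ≃ℝ w → x *ℝ z ≃ℝ y *ℝ w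
*ℝ-cong {x} {y} {z} {w} p q =
  V₁.small-cong (λ n → *-gap (seq x n) (seq z n) (seq y n) (seq w n))
    (V₁.small-+ (V₁.small-* (seq-bounded x) q) (V₁.small-* (seq-bounded w) p))

-ℝ-cong : ∀ {x y} → x ≃ℝ y → -ℝ x ≃ℝ -ℝ y
-ℝ-cong {x} {y} p = V₁.small-cong (λ n → neg-gap (seq x n) (seq y n)) (V₁.small-neg p)

------------------------------------------------------------------------
-- Complex numbers

record ℂ : Set where
  constructor _+i_
  field
    re im : ℝ

open ℂ public

infix 4 _≃ℂ_

_≃ℂ_ : Rel ℂ _
z ≃ℂ w = re z ≃ℝ re w × im z ≃ℝ im w

0ℂ 1ℂ : ℂ
0ℂ = 0ℝ +i 0ℝ
1ℂ = 1ℝ +i 0ℝ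

infixl 6 _+ℂ_
infixl 7 _*ℂ_
infix  8 -ℂ_

_+ℂ_ : ℂ → ℂ → ℂ
z +ℂ w = (re z +ℝ re w) +i (im z +ℝ im w)

_*ℂ_ : ℂ → ℂ → ℂ
z *ℂ w = (re z *ℝ re w +ℝ -ℝ (im z *ℝ im w)) +i (re z *ℝ im w +ℝ im z *ℝ re w)

-ℂ_ : ℂ → ℂ
-ℂ z = (-ℝ re z) +i (-ℝ im z)

conj : ℂ → ℂ
conj z = re z +i (-ℝ im z)

∣_∣² : ℂ → ℝ
∣ z ∣² = re z *ℝ re z +ℝ im z *ℝ im z

private
  pointwiseℂ : ∀ {z w} → (∀ n → seq (re z) n ≡ seq (re w) n) →
               (∀ n → seq (im z) n ≡ seq (im w) n) → z ≃ℂ w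
  pointwiseℂ {z} {w} p q = pointwise {re z} {re w} p , pointwise {im z} {im w} q

abstract
  ℂ-isCommutativeRing : IsCommutativeRing _≃ℂ_ _+ℂ_ _*ℂ_ -ℂ_ 0ℂ 1ℂ
  ℂ-isCommutativeRing = record
    { isRing = record
      { +-isAbelianGroup = record
        { isGroup = record
          { isMonoid = record
            { isSemigroup = record
              { isMagma = record
                { isEquivalence = isEquiv
                ; ∙-cong = λ {x} {y} {z} {w} (p , p′) (q , q′) →
                    +ℝ-cong {re x} {re y} {re z} {re w} p q ,
                    +ℝ-cong {im x} {im y} {im z} {im w} p′ q′
                }
              ; assoc = λ x y z → pointwiseℂ {(x +ℂ y) +ℂ z} {x +ℂ (y +ℂ z)}
                  (λ n → ℚ.+-assoc (seq (re x) n) (seq (re y) n) (seq (re z) n))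
                  (λ n → ℚ.+-assoc (seq (im x) n) (seq (im y) n) (seq (im z) n))
              }
            ; identity =
                (λ x → pointwiseℂ {0ℂ +ℂ x} {x}
                  (λ n → ℚ.+-identityˡ (seq (re x) n)) (λ n → ℚ.+-identityˡ (seq (im x) n))) ,
                (λ x → pointwiseℂ {x +ℂ 0ℂ} {x}
                  (λ n → ℚ.+-identityʳ (seq (re x) n)) (λ n → ℚ.+-identityʳ (seq (im x) n)))
            }
          ; inverse =
              (λ x → pointwiseℂ {(-ℂ x) +ℂ x} {0ℂ}
                (λ n → ℚ.+-inverseˡ (seq (re x) n)) (λ n → ℚ.+-inverseˡ (seq (im x) n))) ,
              (λ x → pointwiseℂ {x +ℂ (-ℂ x)} {0ℂ}
                (λ n → ℚ.+-inverseʳ (seq (re x) n)) (λ n → ℚ.+-inverseʳ (seq (im x) n)))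
          ; ⁻¹-cong = λ {x} {y} (p , q) →
              -ℝ-cong {re x} {re y} p , -ℝ-cong {im x} {im y} q
          }
        ; comm = λ x y → pointwiseℂ {x +ℂ y} {y +ℂ x}
            (λ n → ℚ.+-comm (seq (re x) n) (seq (re y) n))
            (λ n → ℚ.+-comm (seq (im x) n) (seq (im y) n))
        }
      ; *-cong = λ {x} {y} {z} {w} (p , p′) (q , q′) →
          +ℝ-cong {re x *ℝ re z} {re y *ℝ re w} { -ℝ (im x *ℝ im z)} { -ℝ (im y *ℝ im w)}
            (*ℝ-cong {re x} {re y} {re z} {re w} p q)
            (-ℝ-cong {im x *ℝ im z} {im y *ℝ im w} (*ℝ-cong {im x} {im y} {im z} {im w} p′ q′)) ,
          +ℝ-cong {re x *ℝ im z} {re y *ℝ im w} {im x *ℝ re z} {im y *ℝ re w}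
            (*ℝ-cong {re x} {re y} {im z} {im w} p q′)
            (*ℝ-cong {im x} {im y} {re z} {re w} p′ q)
      ; *-assoc = λ x y z → pointwiseℂ {(x *ℂ y) *ℂ z} {x *ℂ (y *ℂ z)}
          (λ n → assoc-re (seq (re x) n) (seq (im x) n) (seq (re y) n) (seq (im y) n) (seq (re z) n) (seq (im z) n))
          (λ n → assoc-im (seq (re x) n) (seq (im x) n) (seq (re y) n) (seq (im y) n) (seq (re z) n) (seq (im z) n))
      ; *-identity =
          (λ x → pointwiseℂ {1ℂ *ℂ x} {x}
            (λ n → idˡ-re (seq (re x) n) (seq (im x) n)) (λ n → idˡ-im (seq (re x) n) (seq (im x) n))) ,
          (λ x → pointwiseℂ {x *ℂ 1ℂ} {x}
            (λ n → idʳ-re (seq (re x) n) (seq (im x) n)) (λ n → idʳ-im (seq (re x) n) (seq (im x) n)))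
      ; distrib =
          (λ x y z → pointwiseℂ {x *ℂ (y +ℂ z)} {x *ℂ y +ℂ x *ℂ z}
            (λ n → distˡ-re (seq (re x) n) (seq (im x) n) (seq (re y) n) (seq (im y) n) (seq (re z) n) (seq (im z) n))
            (λ n → distˡ-im (seq (re x) n) (seq (im x) n) (seq (re y) n) (seq (im y) n) (seq (re z) n) (seq (im z) n))) ,
          (λ x y z → pointwiseℂ {(y +ℂ z) *ℂ x} {y *ℂ x +ℂ z *ℂ x}
            (λ n → distʳ-re (seq (re x) n) (seq (im x) n) (seq (re y) n) (seq (im y) n) (seq (re z) n) (seq (im z) n))
            (λ n → distʳ-im (seq (re x) n) (seq (im x) n) (seq (re y) n) (seq (im y) n) (seq (re z) n) (seq (im z) n)))
      }
    ; *-comm = λ x y → pointwiseℂ {x *ℂ y} {y *ℂ x}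
        (λ n → comm-re (seq (re x) n) (seq (im x) n) (seq (re y) n) (seq (im y) n))
        (λ n → comm-im (seq (re x) n) (seq (im x) n) (seq (re y) n) (seq (im y) n))
    }
    where
    open +-*-Solver
    isEquiv : IsEquivalence _≃ℂ_
    isEquiv = record
      { refl  = λ {x} → ≃ℝ-refl {re x} , ≃ℝ-refl {im x}
      ; sym   = λ {x} {y} (p , q) → ≃ℝ-sym {re x} {re y} p , ≃ℝ-sym {im x} {im y} q
      ; trans = λ {x} {y} {z} (p , p′) (q , q′) →
          ≃ℝ-trans {re x} {re y} {re z} p q , ≃ℝ-trans {im x} {im y} {im z} p′ q′
      }

    mulRe mulIm : ∀ {n} → Polynomial n → Polynomial n → Polynomial n → Polynomial n → Polynomial n
    mulRe a b c d = a :* c :+ :- (b :* d)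
    mulIm a b c d = a :* d :+ b :* c

    reQ imQ : ℚ → ℚ → ℚ → ℚ → ℚ
    reQ a b c d = a ℚ.* c ℚ.+ ℚ.- (b ℚ.* d)
    imQ a b c d = a ℚ.* d ℚ.+ b ℚ.* c

    assoc-re : ∀ a b c d e f → reQ (reQ a b c d) (imQ a b c d) e f ≡ reQ a b (reQ c d e f) (imQ c d e f)
    assoc-re = solve 6 (λ a b c d e f →
      mulRe (mulRe a b c d) (mulIm a b c d) e f := mulRe a b (mulRe c d e f) (mulIm c d e f)) refl
    idˡ-re : ∀ a b → reQ 1ℚ 0ℚ a b ≡ a
    idˡ-re = solve 2 (λ a b →
      mulRe (con 1ℚ) (con 0ℚ) a b := a) refl
    idʳ-re : ∀ a b → reQ a b 1ℚ 0ℚ ≡ a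
    idʳ-re = solve 2 (λ a b →
      mulRe a b (con 1ℚ) (con 0ℚ) := a) refl
    distˡ-re : ∀ a b c d e f → reQ a b (c ℚ.+ e) (d ℚ.+ f) ≡ reQ a b c d ℚ.+ reQ a b e f
    distˡ-re = solve 6 (λ a b c d e f →
      mulRe a b (c :+ e) (d :+ f) := mulRe a b c d :+ mulRe a b e f) refl
    distʳ-re : ∀ a b c d e f → reQ (c ℚ.+ e) (d ℚ.+ f) a b ≡ reQ c d a b ℚ.+ reQ e f a b
    distʳ-re = solve 6 (λ a b c d e f →
      mulRe (c :+ e) (d :+ f) a b := mulRe c d a b :+ mulRe e f a b) refl
    comm-re : ∀ a b c d → reQ a b c d ≡ reQ c d a b
    comm-re = solve 4 (λ a b c d →
      mulRe a b c d := mulRe c d a b) refl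
    assoc-im : ∀ a b c d e f → imQ (reQ a b c d) (imQ a b c d) e f ≡ imQ a b (reQ c d e f) (imQ c d e f)
    assoc-im = solve 6 (λ a b c d e f →
      mulIm (mulRe a b c d) (mulIm a b c d) e f := mulIm a b (mulRe c d e f) (mulIm c d e f)) refl
    idˡ-im : ∀ a b → imQ 1ℚ 0ℚ a b ≡ b
    idˡ-im = solve 2 (λ a b →
      mulIm (con 1ℚ) (con 0ℚ) a b := b) refl
    idʳ-im : ∀ a b → imQ a b 1ℚ 0ℚ ≡ b
    idʳ-im = solve 2 (λ a b →
      mulIm a b (con 1ℚ) (con 0ℚ) := b) refl
    distˡ-im : ∀ a b c d e f → imQ a b (c ℚ.+ e) (d ℚ.+ f) ≡ imQ a b c d ℚ.+ imQ a b e f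
    distˡ-im = solve 6 (λ a b c d e f →
      mulIm a b (c :+ e) (d :+ f) := mulIm a b c d :+ mulIm a b e f) refl
    distʳ-im : ∀ a b c d e f → imQ (c ℚ.+ e) (d ℚ.+ f) a b ≡ imQ c d a b ℚ.+ imQ e f a b
    distʳ-im = solve 6 (λ a b c d e f →
      mulIm (c :+ e) (d :+ f) a b := mulIm c d a b :+ mulIm e f a b) refl
    comm-im : ∀ a b c d → imQ a b c d ≡ imQ c d a b
    comm-im = solve 4 (λ a b c d →
      mulIm a b c d := mulIm c d a b) refl

ℂ-commutativeRing : CommutativeRing _ _
ℂ-commutativeRing = record { isCommutativeRing = ℂ-isCommutativeRing }

ℂ-ring : Ring _ _
ℂ-ring = CommutativeRing.ring ℂ-commutativeRing

------------------------------------------------------------------------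
-- Unital C*-algebras

record UnitalCStarAlgebra (c ℓ : Level) : Set (lsuc (c ⊔ ℓ)) where
  infix  4 _≈_
  infixl 6 _+_
  infixl 7 _*_
  infixr 7 _·_
  infix  8 -_
  infix  9 _⋆
  field
    Carrier : Set c
    _≈_     : Rel Carrier ℓ
    _+_ _*_ : Carrier → Carrier → Carrier
    -_      : Carrier → Carrier
    0# 1#   : Carrier
    _·_     : ℂ → Carrier → Carrier
    _⋆      : Carrier → Carrier
    ‖_‖     : Carrier → ℝ

    isRing       : IsRing _≈_ _+_ _*_ -_ 0# 1#
    isLeftModule : IsLeftModule ℂ-ring _≈_ _+_ 0# -_ _·_
    ·-*-assocˡ   : ∀ z a b → (z · a) * b ≈ z · (a * b)
    ·-*-assocʳ   : ∀ z a b → a * (z · b) ≈ z · (a * b)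

    -- The zero algebra is excluded: over it every matrix is a quantum
    -- permutation matrix and all graphs would be quantum isomorphic.
    1≉0 : ¬ (1# ≈ 0#)

    ⋆-cong       : ∀ {a b} → a ≈ b → a ⋆ ≈ b ⋆
    ⋆-involutive : ∀ a → (a ⋆) ⋆ ≈ a
    ⋆-+          : ∀ a b → (a + b) ⋆ ≈ a ⋆ + b ⋆
    ⋆-*          : ∀ a b → (a * b) ⋆ ≈ b ⋆ * a ⋆
    ⋆-·          : ∀ z a → (z · a) ⋆ ≈ conj z · a ⋆

    ‖‖-cong       : ∀ {a b} → a ≈ b → ‖ a ‖ ≃ℝ ‖ b ‖
    ‖‖-nonneg     : ∀ a → 0ℝ ≤ℝ ‖ a ‖
    ‖‖-definite   : ∀ a → ‖ a ‖ ≃ℝ 0ℝ → a ≈ 0#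
    ‖‖-triangle   : ∀ a b → ‖ a + b ‖ ≤ℝ ‖ a ‖ +ℝ ‖ b ‖
    -- ‖ z · a ‖ = ∣ z ∣ ‖ a ‖, squared so as not to need square roots.
    ‖‖-homogeneous : ∀ z a → ‖ z · a ‖ *ℝ ‖ z · a ‖ ≃ℝ ∣ z ∣² *ℝ (‖ a ‖ *ℝ ‖ a ‖)
    ‖‖-*          : ∀ a b → ‖ a * b ‖ ≤ℝ ‖ a ‖ *ℝ ‖ b ‖
    ‖‖-C⋆         : ∀ a → ‖ a ⋆ * a ‖ ≃ℝ ‖ a ‖ *ℝ ‖ a ‖

    complete : (s : ℕ → Carrier) →
      (∀ ε → 0ℚ ℚ.< ε → ∃ λ N → ∀ m n → N ℕ.≤ m → N ℕ.≤ n → ‖ s m + - s n ‖ ≤ℝ fromℚ ε) →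
      ∃ λ a → ∀ ε → 0ℚ ℚ.< ε → ∃ λ N → ∀ n → N ℕ.≤ n → ‖ s n + - a ‖ ≤ℝ fromℚ ε

  ring : Ring c ℓ
  ring = record { isRing = isRing }

  open MonoidSum (Ring.+-monoid ring) public using (sum)

------------------------------------------------------------------------
-- Graphs and partitions of their vertex sets

record Graph (n : ℕ) : Set where
  field
    adj     : Fin n → Fin n → Bool
    adj-sym : ∀ v w → adj v w ≡ adj w v
    irrefl  : ∀ v → adj v v ≡ false

  neighbours : Fin n → Subset n
  neighbours v = tabulate (adj v)

-- A partition of Fin n into m nonempty cells, given by the map sending an
-- element to the index of its cell.
record Partition (n m : ℕ) : Set where
  field
    cellOf   : Fin n → Fin m
    nonempty : StrictlySurjective _≡_ cellOf

  cell : Fin m → Subset n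
  cell i = tabulate (λ v → ⌊ cellOf v Fin.≟ i ⌋)

open Partition public using (cellOf; cell)

-- The i-th cell of mergeCells V S is the union of the cells V_s, s ∈ S_i.
mergeCells : ∀ {n m l} → Partition n m → Partition m l → Partition n l
mergeCells V S = record
  { cellOf   = λ v → cellOf S (cellOf V v)
  ; nonempty = λ i →
      let (s , s∈Sᵢ) = Partition.nonempty S i
          (v , v∈Vₛ) = Partition.nonempty V s
      in v , trans (cong (cellOf S) v∈Vₛ) s∈Sᵢ
  }

mergeCells-union : ∀ {n m l} (V : Partition n m) (S : Partition m l) i v →
  cellOf (mergeCells V S) v ≡ i ⇔ (∃ λ s → cellOf S s ≡ i × cellOf V v ≡ s)
mergeCells-union V S i v =
  mk⇔ (λ p → cellOf V v , p , refl) (λ (s , p , q) → trans (cong (cellOf S) q) p)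

------------------------------------------------------------------------
-- Godsil–McKay switching.  In a partition π = {C₁,…,C_k,D} into suc k cells
-- the cell Cᵢ has index inject₁ i and D has the last index.

C : ∀ {k} → Fin k → Fin (suc k)
C = inject₁

D : ∀ {k} → Fin (suc k)
D {k} = fromℕ k

module _ {n k : ℕ} (G : Graph n) (π : Partition n (suc k)) where
  open Graph G

  neighboursIn : Fin n → Fin (suc k) → ℕ
  neighboursIn v i = ∣ neighbours v ∩ cell π i ∣

  record GodsilMcKay : Set where
    field
      equitable : ∀ i j v w → cellOf π v ≡ C i → cellOf π w ≡ C i →
        neighboursIn v (C j) ≡ neighboursIn w (C j)
      none-half-all : ∀ v → cellOf π v ≡ D → ∀ i →
        neighboursIn v (C i) ≡ 0
        ⊎ 2 ℕ.* neighboursIn v (C i) ≡ ∣ cell π (C i) ∣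
        ⊎ neighboursIn v (C i) ≡ ∣ cell π (C i) ∣

  -- v ∈ D, w lies in some Cᵢ, and v has exactly nᵢ/2 neighbours in Cᵢ.
  half : Fin n → Fin n → Bool
  half v w = ⌊ cellOf π v Fin.≟ D ⌋ ∧ not ⌊ cellOf π w Fin.≟ D ⌋
    ∧ ⌊ 2 ℕ.* neighboursIn v (cellOf π w) ℕ.≟ ∣ cell π (cellOf π w) ∣ ⌋

  private
    half-irrefl : ∀ v → half v v ≡ false
    half-irrefl v with cellOf π v Fin.≟ D
    ... | yes _ = refl
    ... | no  _ = refl

  switch : Graph n
  switch = record
    { adj     = λ v w → if half v w ∨ half w v then not (adj v w) else adj v w
    ; adj-sym = λ v w → cong₂ (λ b e → if b then not e else e)
                         (∨-comm (half v w) (half w v)) (adj-sym v w)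
    ; irrefl  = λ v → trans (cong (λ b → if b ∨ b then not (adj v v) else adj v v) (half-irrefl v))
                       (irrefl v)
    }

------------------------------------------------------------------------
-- Quantum permutation matrices and quantum isomorphism

module _ {c ℓ} (𝓐 : UnitalCStarAlgebra c ℓ) where
  open UnitalCStarAlgebra 𝓐

  Matrix : ℕ → Set c
  Matrix n = Fin n → Fin n → Carrier

  mul : ∀ {n} → Matrix n → Matrix n → Matrix n
  mul A B i j = sum (λ k → A i k * B k j)

  EqM : ∀ {n} → Matrix n → Matrix n → Set ℓ
  EqM A B = ∀ i j → A i j ≈ B i j

  adjacency : ∀ {n} → Graph n → Matrix n
  adjacency G i j = if Graph.adj G i j then 1# else 0#

  record IsQuantumPermutation {n} (u : Matrix n) : Set ℓ where
    field
      selfAdjoint : ∀ i j → u i j ≈ u i j ⋆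
      idempotent  : ∀ i j → u i j ≈ u i j * u i j
      rowSum      : ∀ i → sum (λ k → u i k) ≈ 1#
      columnSum   : ∀ i → sum (λ k → u k i) ≈ 1#

  BlockDiagonal : ∀ {n m} → Partition n m → Matrix n → Set ℓ
  BlockDiagonal V u = ∀ a b → cellOf V a ≢ cellOf V b → u a b ≈ 0#

QuantumIsomorphic : (c ℓ : Level) {n : ℕ} → Graph n → Graph n → Set (lsuc (c ⊔ ℓ))
QuantumIsomorphic c ℓ {n} G₁ G₂ =
  Σ (UnitalCStarAlgebra c ℓ) λ 𝓐 → Σ (Matrix 𝓐 n) λ u →
    IsQuantumPermutation 𝓐 u ×
    EqM 𝓐 (mul 𝓐 (adjacency 𝓐 G₁) u) (mul 𝓐 u (adjacency 𝓐 G₂))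

{-# OPTIONS --safe #-}
module Submission where

-- The transpose of u intertwines the switched graphs.  Summing the columns of
-- u A₁ = A₂ u over a cell i gives Σᵥ N₂(v,i) u_vb = N₁(b,i) 1, where Nⱼ counts
-- neighbours in i.  If a combination Σ wᵥ qᵥ of projections with weights in ℕ is
-- W 1, then qᵥ = 0 whenever wᵥ > W; together with the same argument for rows,
-- u_ab = 0 unless a (in G₂) and b (in G₁) lie in the same cell and have equally
-- many neighbours in every cell.  Hence, for fixed a and b, all terms that matter
-- in (u A₁′)_ab and (A₂′ u)_ab are switched, or none is; and replacing A₁, A₂ by
-- J − A₁, J − A₂ preserves the relation because rows and columns of u sum to 1.

open import Algebra.Bundles using (CommutativeMonoid; Ring)
open import Algebra.Module.Structures using (IsLeftModule)
import Algebra.Properties.CommutativeSemigroup as CommutativeSemigroupProperties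
import Algebra.Properties.Ring as RingProperties
import Algebra.Properties.Semiring.Mult as SemiringMult
import Algebra.Properties.Semiring.Sum as SemiringSum
open import Data.Bool.Base using (Bool; true; false; not; if_then_else_; _∧_; _∨_)
open import Data.Fin.Base using (Fin; zero; suc; punchIn)
open import Data.Fin.Subset using (∣_∣; _∩_)
import Data.Fin.Properties as Fin
open import Data.Nat.Base as ℕ using (ℕ; zero; suc)
import Data.Nat.Properties as ℕ
open import Data.Product.Base using (_×_; _,_)
open import Data.Rational.Base as ℚ using (ℚ; 0ℚ; 1ℚ; ½)
import Data.Rational.Properties as ℚ
open import Data.Rational.Solver using (module +-*-Solver)
open import Data.Sum.Base using (_⊎_; inj₁; inj₂)
open import Data.Vec.Base using (tabulate)
open import Data.Vec.Functional using (removeAt)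
open import Level using (Level; _⊔_)
open import Relation.Binary.PropositionalEquality as ≡ using (_≡_; _≢_; cong; cong₂; subst; subst₂)
open import Relation.Binary.Definitions using (tri<; tri≈; tri>)
import Relation.Binary.Reasoning.Setoid as SetoidReasoning
open import Relation.Nullary.Decidable using (⌊_⌋; yes; no)
open import Relation.Nullary.Negation using (contradiction)
open import Defs

-- Order on the reals

∣p∣-∣q∣≤∣p-q∣ : ∀ p q → ℚ.∣ p ∣ ℚ.- ℚ.∣ q ∣ ℚ.≤ ℚ.∣ p ℚ.- q ∣
∣p∣-∣q∣≤∣p-q∣ p q = subst (ℚ.∣ p ∣ ℚ.- ℚ.∣ q ∣ ℚ.≤_) (cancel ℚ.∣ p ℚ.- q ∣ ℚ.∣ q ∣)
  (ℚ.+-monoˡ-≤ (ℚ.- ℚ.∣ q ∣)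
    (subst (λ r → ℚ.∣ r ∣ ℚ.≤ ℚ.∣ p ℚ.- q ∣ ℚ.+ ℚ.∣ q ∣) (split p q)
      (ℚ.∣p+q∣≤∣p∣+∣q∣ (p ℚ.- q) q)))
  where
  open +-*-Solver
  cancel : ∀ a b → a ℚ.+ b ℚ.- b ≡ a
  cancel = solve 2 (λ a b → a :+ b :- b := a) ≡.refl
  split : ∀ a b → a ℚ.- b ℚ.+ b ≡ a
  split = solve 2 (λ a b → a :- b :+ b := a) ≡.refl

-[p-q]≡q-p : ∀ p q → ℚ.- (p ℚ.- q) ≡ q ℚ.- p
-[p-q]≡q-p = solve 2 (λ p q → :- (p :- q) := q :- p) ≡.refl
  where open +-*-Solver

∣p-q∣≡∣q-p∣ : ∀ p q → ℚ.∣ p ℚ.- q ∣ ≡ ℚ.∣ q ℚ.- p ∣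
∣p-q∣≡∣q-p∣ p q = ≡.trans (≡.sym (ℚ.∣-p∣≡∣p∣ (p ℚ.- q))) (cong ℚ.∣_∣ (-[p-q]≡q-p p q))

p≤∣p∣ : ∀ p → p ℚ.≤ ℚ.∣ p ∣
p≤∣p∣ p with ℚ.≤-total 0ℚ p
... | inj₁ 0≤p = ℚ.≤-reflexive (≡.sym (ℚ.0≤p⇒∣p∣≡p 0≤p))
... | inj₂ p≤0 = ℚ.≤-trans p≤0 (ℚ.0≤∣p∣ p)

∣∣p∣-∣q∣∣≤∣p-q∣ : ∀ p q → ℚ.∣ ℚ.∣ p ∣ ℚ.- ℚ.∣ q ∣ ∣ ℚ.≤ ℚ.∣ p ℚ.- q ∣
∣∣p∣-∣q∣∣≤∣p-q∣ p q with ℚ.∣p∣≡p∨∣p∣≡-p (ℚ.∣ p ∣ ℚ.- ℚ.∣ q ∣)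
... | inj₁ eq = subst (ℚ._≤ ℚ.∣ p ℚ.- q ∣) (≡.sym eq) (∣p∣-∣q∣≤∣p-q∣ p q)
... | inj₂ eq = subst₂ ℚ._≤_ (≡.sym (≡.trans eq (-[p-q]≡q-p ℚ.∣ p ∣ ℚ.∣ q ∣)))
                  (∣p-q∣≡∣q-p∣ q p) (∣p∣-∣q∣≤∣p-q∣ q p)

-- Represents a nonnegative real by a sequence of nonnegative terms, so that products can be
-- estimated termwise.
absℝ : ℝ → ℝ
absℝ x = mkℝ (λ n → ℚ.∣ seq x n ∣) λ ε ε>0 →
  let (N , close) = cauchy x ε ε>0 in
  N , λ m n N≤m N≤n → ℚ.≤-<-trans (∣∣p∣-∣q∣∣≤∣p-q∣ (seq x m) (seq x n)) (close m n N≤m N≤n)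

-- A record rather than _≤ℝ_ itself, which unfolds and so does not determine
-- its arguments.
infix 4 _⊑_
record _⊑_ (x y : ℝ) : Set where
  constructor ⟨_⟩
  field ⊑⇒≤ℝ : x ≤ℝ y
open _⊑_

halfℚ : ∀ ε → ½ ℚ.* ε ℚ.+ ½ ℚ.* ε ≡ ε
halfℚ = solve 1 (λ ε → con ½ :* ε :+ con ½ :* ε := ε) ≡.refl
  where open +-*-Solver

halfℚ-pos : ∀ {ε} → 0ℚ ℚ.< ε → 0ℚ ℚ.< ½ ℚ.* ε
halfℚ-pos {ε} ε>0 = subst (ℚ._< ½ ℚ.* ε) (ℚ.*-zeroʳ ½) (ℚ.*-monoʳ-<-pos ½ ε>0)

p≤p+ε : ∀ p {ε} → 0ℚ ℚ.< ε → p ℚ.≤ p ℚ.+ ε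
p≤p+ε p {ε} ε>0 = subst (ℚ._≤ p ℚ.+ ε) (ℚ.+-identityʳ p) (ℚ.+-monoʳ-≤ p (ℚ.<⇒≤ ε>0))

⊑-pointwise : ∀ {x y} → (∀ n → seq x n ℚ.≤ seq y n) → x ⊑ y
⊑-pointwise {x} {y} le = ⟨ (λ ε ε>0 → 0 , λ n _ → ℚ.≤-trans (le n) (p≤p+ε (seq y n) ε>0)) ⟩

⊑-pointwise-≡ : ∀ {x y} → (∀ n → seq x n ≡ seq y n) → x ⊑ y
⊑-pointwise-≡ eq = ⊑-pointwise λ n → ℚ.≤-reflexive (eq n)

≃ℝ⇒⊑ : ∀ x y → x ≃ℝ y → x ⊑ y
≃ℝ⇒⊑ x y x≃y = ⟨ (λ ε ε>0 → let (N , close) = x≃y ε ε>0 in N , λ n N≤n →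
  subst (ℚ._≤ seq y n ℚ.+ ε) (recover (seq y n) (seq x n))
    (ℚ.+-monoʳ-≤ (seq y n) (ℚ.≤-trans (p≤∣p∣ (seq x n ℚ.- seq y n)) (ℚ.<⇒≤ (close n N≤n))))) ⟩
  where
  open +-*-Solver
  recover : ∀ b a → b ℚ.+ (a ℚ.- b) ≡ a
  recover = solve 2 (λ b a → b :+ (a :- b) := a) ≡.refl

⊑-trans : ∀ {x y z} → x ⊑ y → y ⊑ z → x ⊑ z
⊑-trans {x} {y} {z} ⟨ p ⟩ ⟨ q ⟩ = ⟨ (λ ε ε>0 →
  let (M , b) = p (½ ℚ.* ε) (halfℚ-pos ε>0)
      (N , c) = q (½ ℚ.* ε) (halfℚ-pos ε>0)
  in M ℕ.⊔ N , λ n le → subst (seq x n ℚ.≤_)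
       (≡.trans (ℚ.+-assoc (seq z n) (½ ℚ.* ε) (½ ℚ.* ε)) (cong (seq z n ℚ.+_) (halfℚ ε)))
       (ℚ.≤-trans (b n (ℕ.m⊔n≤o⇒m≤o M N le))
         (ℚ.+-monoˡ-≤ (½ ℚ.* ε) (c n (ℕ.m⊔n≤o⇒n≤o M N le))))) ⟩

+ℝ-mono-⊑ : ∀ {x y z w} → x ⊑ y → z ⊑ w → x +ℝ z ⊑ y +ℝ w
+ℝ-mono-⊑ {x} {y} {z} {w} ⟨ p ⟩ ⟨ q ⟩ = ⟨ (λ ε ε>0 →
  let (M , b) = p (½ ℚ.* ε) (halfℚ-pos ε>0)
      (N , c) = q (½ ℚ.* ε) (halfℚ-pos ε>0)
  in M ℕ.⊔ N , λ n le → subst (seq x n ℚ.+ seq z n ℚ.≤_)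
       (≡.trans (interchange (seq y n) (seq w n) (½ ℚ.* ε))
         (cong (seq y n ℚ.+ seq w n ℚ.+_) (halfℚ ε)))
       (ℚ.+-mono-≤ (b n (ℕ.m⊔n≤o⇒m≤o M N le)) (c n (ℕ.m⊔n≤o⇒n≤o M N le)))) ⟩
  where
  open +-*-Solver
  interchange : ∀ a b e → (a ℚ.+ e) ℚ.+ (b ℚ.+ e) ≡ (a ℚ.+ b) ℚ.+ (e ℚ.+ e)
  interchange = solve 3 (λ a b e → (a :+ e) :+ (b :+ e) := (a :+ b) :+ (e :+ e)) ≡.refl

⊑-refl : ∀ {x} → x ⊑ x
⊑-refl = ⊑-pointwise λ n → ℚ.≤-refl

x⊑y⇒0⊑y-x : ∀ {x y} → x ⊑ y → 0ℝ ⊑ y +ℝ (-ℝ x)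
x⊑y⇒0⊑y-x {x} {y} x⊑y = ⊑-trans (⊑-pointwise-≡ λ n → ≡.sym (ℚ.+-inverseʳ (seq x n)))
  (+ℝ-mono-⊑ x⊑y (⊑-refl { -ℝ x}))

nonneg⇒≃abs : ∀ {x} → 0ℝ ⊑ x → x ≃ℝ absℝ x
nonneg⇒≃abs {x} ⟨ p ⟩ ε ε>0 =
  let (N , b) = p δ (halfℚ-pos (halfℚ-pos ε>0)) in N , λ n N≤n → close (seq x n) (b n N≤n)
  where
  -- A negative term `a` with -δ ≤ a differs from its absolute value by -2a ≤ 2δ = ε/2, which is
  -- strictly below ε.
  δ = ½ ℚ.* (½ ℚ.* ε)
  open +-*-Solver
  double-neg : ∀ a → ℚ.- (a ℚ.- (ℚ.- a)) ≡ (ℚ.- a) ℚ.+ (ℚ.- a)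
  double-neg = solve 1 (λ a → :- (a :- (:- a)) := (:- a) :+ (:- a)) ≡.refl
  shift : ∀ a d → (a ℚ.+ d) ℚ.- a ≡ d
  shift = solve 2 (λ a d → (a :+ d) :- a := d) ≡.refl
  close : ∀ a → 0ℚ ℚ.≤ a ℚ.+ δ → ℚ.∣ a ℚ.- ℚ.∣ a ∣ ∣ ℚ.< ε
  close a 0≤a+δ with ℚ.≤-total 0ℚ a
  ... | inj₁ 0≤a = subst (ℚ._< ε) (≡.sym (cong ℚ.∣_∣
          (≡.trans (cong (ℚ._-_ a) (ℚ.0≤p⇒∣p∣≡p 0≤a)) (ℚ.+-inverseʳ a)))) ε>0
  ... | inj₂ a≤0 = subst (ℚ._< ε) (≡.sym ∣a-∣a∣∣≡)
          (ℚ.≤-<-trans (ℚ.+-mono-≤ -a≤δ -a≤δ)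
            (subst (ℚ._< ε) (≡.sym (halfℚ (½ ℚ.* ε)))
              (subst₂ ℚ._<_ (ℚ.+-identityʳ (½ ℚ.* ε)) (halfℚ ε)
                (ℚ.+-monoʳ-< (½ ℚ.* ε) (halfℚ-pos ε>0)))))
    where
    0≤-a : 0ℚ ℚ.≤ ℚ.- a
    0≤-a = ℚ.neg-antimono-≤ a≤0
    -a≤δ : ℚ.- a ℚ.≤ δ
    -a≤δ = subst₂ ℚ._≤_ (ℚ.+-identityˡ (ℚ.- a)) (shift a δ) (ℚ.+-monoˡ-≤ (ℚ.- a) 0≤a+δ)
    ∣a∣≡-a : ℚ.∣ a ∣ ≡ ℚ.- a
    ∣a∣≡-a = ≡.trans (≡.sym (ℚ.∣-p∣≡∣p∣ a)) (ℚ.0≤p⇒∣p∣≡p 0≤-a)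
    ∣a-∣a∣∣≡ : ℚ.∣ a ℚ.- ℚ.∣ a ∣ ∣ ≡ (ℚ.- a) ℚ.+ (ℚ.- a)
    ∣a-∣a∣∣≡ = ≡.trans (cong (λ b → ℚ.∣ a ℚ.- b ∣) ∣a∣≡-a)
      (≡.trans (≡.sym (ℚ.∣-p∣≡∣p∣ (a ℚ.- (ℚ.- a))))
        (≡.trans (cong ℚ.∣_∣ (double-neg a)) (ℚ.0≤p⇒∣p∣≡p (ℚ.+-mono-≤ 0≤-a 0≤-a))))

-- The product equals that of the absolute values, whose terms are all nonnegative.
*ℝ-nonneg : ∀ {x y} → 0ℝ ⊑ x → 0ℝ ⊑ y → 0ℝ ⊑ x *ℝ y
*ℝ-nonneg {x} {y} 0⊑x 0⊑y = ⊑-trans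
  (⊑-pointwise λ n → subst (0ℚ ℚ.≤_) (ℚ.∣p*q∣≡∣p∣*∣q∣ (seq x n) (seq y n)) (ℚ.0≤∣p∣ _))
  (≃ℝ⇒⊑ (absℝ x *ℝ absℝ y) (x *ℝ y)
    (≃ℝ-sym {x *ℝ y} {absℝ x *ℝ absℝ y}
      (*ℝ-cong {x} {absℝ x} {y} {absℝ y} (nonneg⇒≃abs 0⊑x) (nonneg⇒≃abs 0⊑y))))

-- Write y z = (y - x) z + x z, with a nonnegative first summand.
*ℝ-monoˡ-⊑ : ∀ {x y z} → 0ℝ ⊑ z → x ⊑ y → x *ℝ z ⊑ y *ℝ z
*ℝ-monoˡ-⊑ {x} {y} {z} 0⊑z x⊑y = ⊑-trans
  (⊑-pointwise-≡ λ n → ≡.sym (ℚ.+-identityˡ (seq x n ℚ.* seq z n)))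
  (⊑-trans (+ℝ-mono-⊑ (*ℝ-nonneg (x⊑y⇒0⊑y-x x⊑y) 0⊑z) (⊑-refl {x *ℝ z}))
    (⊑-pointwise-≡ λ n → expand (seq x n) (seq y n) (seq z n)))
  where
  open +-*-Solver
  expand : ∀ a b c → (b ℚ.+ ℚ.- a) ℚ.* c ℚ.+ a ℚ.* c ≡ b ℚ.* c
  expand = solve 3 (λ a b c → (b :+ :- a) :* c :+ a :* c := b :* c) ≡.refl

*ℝ-comm-⊑ : ∀ x y → x *ℝ y ⊑ y *ℝ x
*ℝ-comm-⊑ x y = ⊑-pointwise-≡ λ n → ℚ.*-comm (seq x n) (seq y n)

*ℝ-monoʳ-⊑ : ∀ {x y z} → 0ℝ ⊑ z → x ⊑ y → z *ℝ x ⊑ z *ℝ y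
*ℝ-monoʳ-⊑ {x} {y} {z} 0⊑z x⊑y =
  ⊑-trans (*ℝ-comm-⊑ z x) (⊑-trans (*ℝ-monoˡ-⊑ 0⊑z x⊑y) (*ℝ-comm-⊑ y z))

⊑-antisym-0 : ∀ {x} → x ⊑ 0ℝ → 0ℝ ⊑ x → x ≃ℝ 0ℝ
⊑-antisym-0 {x} x⊑0 0⊑x ε ε>0 =
  -- Since x ≥ 0, x equals its absolute value, so the upper bound on x bounds the absolute values of
  -- its terms.
  let (N , b) = ⊑⇒≤ℝ (⊑-trans (≃ℝ⇒⊑ (absℝ x) x (≃ℝ-sym {x} {absℝ x} (nonneg⇒≃abs 0⊑x))) x⊑0)
                  (½ ℚ.* ε) (halfℚ-pos ε>0)
  in N , λ n N≤n → subst (ℚ._< ε) (cong ℚ.∣_∣ (≡.sym (ℚ.+-identityʳ (seq x n))))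
       (ℚ.≤-<-trans (b n N≤n)
         (subst₂ ℚ._<_ ≡.refl (halfℚ ε) (ℚ.+-monoˡ-< (½ ℚ.* ε) (halfℚ-pos ε>0))))

-- A term a > 1 + ε would give a² - a = a (a - 1) ≥ a - 1 ≥ ε, against the closeness of a² and a.
idempotent⇒⊑1 : ∀ x → x *ℝ x ≃ℝ x → x ⊑ 1ℝ
idempotent⇒⊑1 x x²≃x = ⟨ (λ ε ε>0 → let (N , close) = x²≃x ε ε>0 in N , λ n N≤n →
  bound ε (seq x n) ε>0 (close n N≤n)) ⟩
  where
  open +-*-Solver
  factor : ∀ a → a ℚ.* (a ℚ.- 1ℚ) ≡ a ℚ.* a ℚ.- a
  factor = solve 1 (λ a → a :* (a :- con 1ℚ) := a :* a :- a) ≡.refl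
  shift : ∀ e → (1ℚ ℚ.+ e) ℚ.- 1ℚ ≡ e
  shift = solve 1 (λ e → (con 1ℚ :+ e) :- con 1ℚ := e) ≡.refl
  bound : ∀ ε a → 0ℚ ℚ.< ε → ℚ.∣ a ℚ.* a ℚ.- a ∣ ℚ.< ε → a ℚ.≤ 1ℚ ℚ.+ ε
  bound ε a ε>0 small with a ℚ.≤? 1ℚ ℚ.+ ε
  ... | yes a≤1+ε = a≤1+ε
  ... | no a≰1+ε = contradiction (ℚ.<-≤-trans small (ℚ.≤-trans ε≤a²-a (p≤∣p∣ _))) (ℚ.<-irrefl ≡.refl)
    where
    1+ε≤a : 1ℚ ℚ.+ ε ℚ.≤ a
    1+ε≤a = ℚ.<⇒≤ (ℚ.≰⇒> a≰1+ε)
    ε≤a-1 : ε ℚ.≤ a ℚ.- 1ℚ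
    ε≤a-1 = subst (ℚ._≤ a ℚ.- 1ℚ) (shift ε) (ℚ.+-monoˡ-≤ (ℚ.- 1ℚ) 1+ε≤a)
    1≤a : 1ℚ ℚ.≤ a
    1≤a = ℚ.≤-trans (p≤p+ε 1ℚ ε>0) 1+ε≤a
    ε≤a²-a : ε ℚ.≤ a ℚ.* a ℚ.- a
    ε≤a²-a = ℚ.≤-trans ε≤a-1 (subst₂ ℚ._≤_ (ℚ.*-identityˡ (a ℚ.- 1ℚ)) (factor a)
      (ℚ.*-monoʳ-≤-nonNeg (a ℚ.- 1ℚ)
        {{ℚ.nonNegative (ℚ.≤-trans (ℚ.<⇒≤ ε>0) ε≤a-1)}} 1≤a))

-- Natural numbers as scalars.

fromℕℚ : ℕ → ℚ
fromℕℚ zero    = 0ℚ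
fromℕℚ (suc M) = 1ℚ ℚ.+ fromℕℚ M

fromℕℝ : ℕ → ℝ
fromℕℝ M = fromℚ (fromℕℚ M)

fromℕℂ : ℕ → ℂ
fromℕℂ M = fromℕℝ M +i 0ℝ

0≤fromℕℚ : ∀ M → 0ℚ ℚ.≤ fromℕℚ M
0≤fromℕℚ zero    = ℚ.≤-refl
0≤fromℕℚ (suc M) = ℚ.+-mono-≤ (ℚ.<⇒≤ (ℚ.positive⁻¹ 1ℚ)) (0≤fromℕℚ M)

fromℕℚ-homo-+ : ∀ M N → fromℕℚ (M ℕ.+ N) ≡ fromℕℚ M ℚ.+ fromℕℚ N
fromℕℚ-homo-+ zero    N = ≡.sym (ℚ.+-identityˡ (fromℕℚ N))
fromℕℚ-homo-+ (suc M) N = ≡.trans (cong (1ℚ ℚ.+_) (fromℕℚ-homo-+ M N))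
  (≡.sym (ℚ.+-assoc 1ℚ (fromℕℚ M) (fromℕℚ N)))

-- Meant for α = ‖p‖ and β = ‖(M + 1) p‖. Then α² + M² α² ≤ (M + 1)² α² = β² ≤ M² α², so α = α² ≤ 0.
-- Squares are compared because homogeneity of the norm is stated for squares.
shrinking-idempotent-≃0 : ∀ M {α β} → 0ℝ ⊑ α → 0ℝ ⊑ β → α *ℝ α ≃ℝ α →
  β *ℝ β ≃ℝ ∣ fromℕℂ (suc M) ∣² *ℝ (α *ℝ α) → β ⊑ fromℕℝ M *ℝ α → α ≃ℝ 0ℝ
shrinking-idempotent-≃0 M {α} {β} 0⊑α 0⊑β α²≃α β²≃ β⊑mα = ⊑-antisym-0
  (⊑-trans (≃ℝ⇒⊑ α (α *ℝ α) (≃ℝ-sym {α *ℝ α} {α} α²≃α)) α²⊑0) 0⊑α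
  where
  m = fromℕℝ M
  mα = m *ℝ α
  0⊑mα : 0ℝ ⊑ mα
  0⊑mα = *ℝ-nonneg (⊑-pointwise λ _ → 0≤fromℕℚ M) 0⊑α

  β²⊑m²α² : β *ℝ β ⊑ mα *ℝ mα
  β²⊑m²α² = ⊑-trans (*ℝ-monoˡ-⊑ 0⊑β β⊑mα) (*ℝ-monoʳ-⊑ 0⊑mα β⊑mα)

  open +-*-Solver
  square-expand : ∀ m a → ((1ℚ ℚ.+ m) ℚ.* (1ℚ ℚ.+ m) ℚ.+ 0ℚ ℚ.* 0ℚ) ℚ.* (a ℚ.* a)
    ≡ (a ℚ.* a ℚ.+ (m ℚ.* a) ℚ.* (m ℚ.* a)) ℚ.+ (m ℚ.+ m) ℚ.* (a ℚ.* a)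
  square-expand = solve 2 (λ m a →
    ((con 1ℚ :+ m) :* (con 1ℚ :+ m) :+ con 0ℚ :* con 0ℚ) :* (a :* a)
    := (a :* a :+ (m :* a) :* (m :* a)) :+ (m :+ m) :* (a :* a)) ≡.refl
  add-sub : ∀ a b → (a ℚ.+ b) ℚ.+ ℚ.- b ≡ a
  add-sub = solve 2 (λ a b → (a :+ b) :+ :- b := a) ≡.refl

  0≤m : 0ℚ ℚ.≤ fromℕℚ M ℚ.+ fromℕℚ M
  0≤m = ℚ.+-mono-≤ (0≤fromℕℚ M) (0≤fromℕℚ M)

  0≤square : ∀ a → 0ℚ ℚ.≤ a ℚ.* a
  0≤square a with ℚ.≤-total 0ℚ a
  ... | inj₁ 0≤a = subst (ℚ._≤ a ℚ.* a) (ℚ.*-zeroˡ a) (ℚ.*-monoʳ-≤-nonNeg a {{ℚ.nonNegative 0≤a}} 0≤a)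
  ... | inj₂ a≤0 = subst (ℚ._≤ a ℚ.* a) (ℚ.*-zeroˡ a) (ℚ.*-monoʳ-≤-nonPos a {{ℚ.nonPositive a≤0}} a≤0)

  -- The cross term 2M α² of (M + 1)² α² is nonnegative in every term of the sequence and is
  -- dropped.
  α²+m²α²⊑β² : α *ℝ α +ℝ mα *ℝ mα ⊑ β *ℝ β
  α²+m²α²⊑β² = ⊑-trans
    (⊑-pointwise {α *ℝ α +ℝ mα *ℝ mα} {∣ fromℕℂ (suc M) ∣² *ℝ (α *ℝ α)} λ n → let a = seq α n in
      subst₂ ℚ._≤_ (ℚ.+-identityʳ _) (≡.sym (square-expand (fromℕℚ M) a))
        (ℚ.+-monoʳ-≤ (a ℚ.* a ℚ.+ (fromℕℚ M ℚ.* a) ℚ.* (fromℕℚ M ℚ.* a))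
          (subst (ℚ._≤ (fromℕℚ M ℚ.+ fromℕℚ M) ℚ.* (a ℚ.* a)) (ℚ.*-zeroˡ (a ℚ.* a))
            (ℚ.*-monoʳ-≤-nonNeg (a ℚ.* a) {{ℚ.nonNegative (0≤square a)}} 0≤m))))
    (≃ℝ⇒⊑ (∣ fromℕℂ (suc M) ∣² *ℝ (α *ℝ α)) (β *ℝ β)
      (≃ℝ-sym {β *ℝ β} {∣ fromℕℂ (suc M) ∣² *ℝ (α *ℝ α)} β²≃))

  α²⊑0 : α *ℝ α ⊑ 0ℝ
  α²⊑0 = ⊑-trans (⊑-pointwise-≡ λ n → ≡.sym (add-sub (seq (α *ℝ α) n) (seq (mα *ℝ mα) n)))
    (⊑-trans (+ℝ-mono-⊑ (⊑-trans α²+m²α²⊑β² β²⊑m²α²) (⊑-refl { -ℝ (mα *ℝ mα)}))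
      (⊑-pointwise-≡ λ n → ℚ.+-inverseʳ (seq (mα *ℝ mα) n)))

-- Projections in C*-algebras

module Projections {c ℓ} (𝓐 : UnitalCStarAlgebra c ℓ) where
  open UnitalCStarAlgebra 𝓐
  open Ring ring using (setoid; semiring; +-commutativeMonoid; refl; sym; trans; +-cong; +-congˡ;
    +-congʳ; +-assoc; +-comm; +-identityˡ; +-identityʳ; -‿cong; -‿inverseʳ; -‿inverseˡ; *-congˡ;
    *-congʳ; *-identityˡ; *-identityʳ; zeroˡ; distribˡ; distribʳ)
  open CommutativeSemigroupProperties (CommutativeMonoid.commutativeSemigroup +-commutativeMonoid)
    using (interchange)
  open SemiringSum semiring using (sum-remove)
  open SemiringMult semiring renaming (_×_ to _⨯_)
  open RingProperties ring using (+-cancelˡ; -‿distribˡ-*; -‿distribʳ-*; -‿involutive)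
  open IsLeftModule isLeftModule using (*ₗ-cong; *ₗ-distribʳ; *ₗ-identityˡ; *ₗ-zeroˡ)
  open SetoidReasoning setoid

  -- Makes homogeneity of the norm, an axiom about complex scalars, available for natural multiples.
  fromℕℂ-· : ∀ M a → fromℕℂ M · a ≈ M ⨯ a
  fromℕℂ-· zero    a = *ₗ-zeroˡ a
  fromℕℂ-· (suc M) a = begin
    -- Both scalars have the same rational sequences but different Cauchy proofs, so they are only
    -- equivalent.
    fromℕℂ (suc M) · a      ≈⟨ *ₗ-cong (pointwise {fromℕℝ (suc M)} {1ℝ +ℝ fromℕℝ M} (λ _ → ≡.refl)
                                       , pointwise {0ℝ} {0ℝ +ℝ 0ℝ} (λ _ → ≡.refl)) refl ⟩
    (1ℂ +ℂ fromℕℂ M) · a    ≈⟨ *ₗ-distribʳ a 1ℂ (fromℕℂ M) ⟩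
    1ℂ · a + fromℕℂ M · a   ≈⟨ +-cong (*ₗ-identityˡ a) (fromℕℂ-· M a) ⟩
    a + M ⨯ a               ∎

  0⋆≈0 : 0# ⋆ ≈ 0#
  0⋆≈0 = +-cancelˡ (0# ⋆) (0# ⋆) 0# (begin
    0# ⋆ + 0# ⋆  ≈⟨ ⋆-+ 0# 0# ⟨
    (0# + 0#) ⋆  ≈⟨ ⋆-cong (+-identityˡ 0#) ⟩
    0# ⋆         ≈⟨ +-identityʳ (0# ⋆) ⟨
    0# ⋆ + 0#    ∎)

  1⋆≈1 : 1# ⋆ ≈ 1#
  1⋆≈1 = begin
    1# ⋆               ≈⟨ *-identityˡ (1# ⋆) ⟨
    1# * 1# ⋆          ≈⟨ *-congʳ (⋆-involutive 1#) ⟨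
    (1# ⋆) ⋆ * 1# ⋆    ≈⟨ ⋆-* 1# (1# ⋆) ⟨
    (1# * 1# ⋆) ⋆      ≈⟨ ⋆-cong (*-identityˡ (1# ⋆)) ⟩
    (1# ⋆) ⋆           ≈⟨ ⋆-involutive 1# ⟩
    1#                 ∎

  ⋆-neg : ∀ a → (- a) ⋆ ≈ - (a ⋆)
  ⋆-neg a = +-cancelˡ (a ⋆) ((- a) ⋆) (- (a ⋆)) (begin
    a ⋆ + (- a) ⋆  ≈⟨ ⋆-+ a (- a) ⟨
    (a + - a) ⋆    ≈⟨ ⋆-cong (-‿inverseʳ a) ⟩
    0# ⋆           ≈⟨ 0⋆≈0 ⟩
    0#             ≈⟨ -‿inverseʳ (a ⋆) ⟨
    a ⋆ + - (a ⋆)  ∎)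

  0⊑‖‖ : ∀ a → 0ℝ ⊑ ‖ a ‖
  0⊑‖‖ a = ⟨ ‖‖-nonneg a ⟩

  ‖‖-*-⊑ : ∀ a b → ‖ a * b ‖ ⊑ ‖ a ‖ *ℝ ‖ b ‖
  ‖‖-*-⊑ a b = ⟨ ‖‖-* a b ⟩

  record IsProjection (p : Carrier) : Set ℓ where
    field
      selfAdjoint : p ≈ p ⋆
      idempotent  : p ≈ p * p
  open IsProjection

  0-isProjection : IsProjection 0#
  0-isProjection = record { selfAdjoint = sym 0⋆≈0 ; idempotent = sym (zeroˡ 0#) }

  complement-isProjection : ∀ {p} → IsProjection p → IsProjection (1# + - p)
  complement-isProjection {p} proj = record
    { selfAdjoint = sym (trans (⋆-+ 1# (- p))
        (+-cong 1⋆≈1 (trans (⋆-neg p) (-‿cong (sym (selfAdjoint proj))))))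
    ; idempotent = sym (begin
        (1# + - p) * (1# + - p)              ≈⟨ distribʳ (1# + - p) 1# (- p) ⟩
        1# * (1# + - p) + - p * (1# + - p)   ≈⟨ +-cong (*-identityˡ _) kill ⟩
        (1# + - p) + 0#                      ≈⟨ +-identityʳ _ ⟩
        1# + - p                             ∎)
    }
    where
    kill : - p * (1# + - p) ≈ 0#
    kill = begin
      - p * (1# + - p)       ≈⟨ distribˡ (- p) 1# (- p) ⟩
      - p * 1# + - p * - p   ≈⟨ +-cong (*-identityʳ (- p)) (trans (sym (-‿distribˡ-* p (- p)))
                                 (trans (-‿cong (sym (-‿distribʳ-* p p)))
                                   (trans (-‿involutive (p * p)) (sym (idempotent proj))))) ⟩
      - p + p                ≈⟨ -‿inverseˡ p ⟩
      0#                     ∎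

  -- The C*-identity applied to p = p* p.
  ‖projection‖² : ∀ {p} → IsProjection p → ‖ p ‖ *ℝ ‖ p ‖ ≃ℝ ‖ p ‖
  ‖projection‖² {p} proj = ≃ℝ-sym {‖ p ‖} {‖ p ‖ *ℝ ‖ p ‖}
    (≃ℝ-trans {‖ p ‖} {‖ p ⋆ * p ‖} {‖ p ‖ *ℝ ‖ p ‖}
      (‖‖-cong (trans (idempotent proj) (*-congʳ (selfAdjoint proj)))) (‖‖-C⋆ p))

  ‖projection‖⊑1 : ∀ {p} → IsProjection p → ‖ p ‖ ⊑ 1ℝ
  ‖projection‖⊑1 {p} proj = idempotent⇒⊑1 ‖ p ‖ (‖projection‖² proj)

  -- A norm-theoretic stand-in for positivity: ‖ M − s ‖ ≤ M for some M.
  record Accretive (s : Carrier) : Set (c ⊔ ℓ) where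
    field
      bound     : ℕ
      rest      : Carrier
      rest+s    : rest + s ≈ bound ⨯ 1#
      ‖rest‖⊑   : ‖ rest ‖ ⊑ fromℕℝ bound

  accretive-+ : ∀ {s t} → Accretive s → Accretive t → Accretive (s + t)
  accretive-+ {s} {t} S T = record
    { bound   = S.bound ℕ.+ T.bound
    ; rest    = S.rest + T.rest
    ; rest+s  = begin
        (S.rest + T.rest) + (s + t)        ≈⟨ interchange S.rest T.rest s t ⟩
        (S.rest + s) + (T.rest + t)        ≈⟨ +-cong S.rest+s T.rest+s ⟩
        S.bound ⨯ 1# + T.bound ⨯ 1#        ≈⟨ ×-homo-+ 1# S.bound T.bound ⟨
        (S.bound ℕ.+ T.bound) ⨯ 1#         ∎
    ; ‖rest‖⊑ = ⊑-trans ⟨ ‖‖-triangle S.rest T.rest ⟩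
        (⊑-trans (+ℝ-mono-⊑ S.‖rest‖⊑ T.‖rest‖⊑)
          (⊑-pointwise-≡ λ _ → ≡.sym (fromℕℚ-homo-+ S.bound T.bound)))
    }
    where
    module S = Accretive S
    module T = Accretive T

  projection-accretive : ∀ {p} → IsProjection p → Accretive p
  projection-accretive {p} proj = record
    -- The remainder 1 - p is again a projection, so its norm is at most 1.
    { bound   = 1
    ; rest    = 1# + - p
    ; rest+s  = trans (+-assoc 1# (- p) p) (+-congˡ (-‿inverseˡ p))
    ; ‖rest‖⊑ = ⊑-trans (‖projection‖⊑1 (complement-isProjection proj))
        (⊑-pointwise-≡ λ _ → ≡.sym (ℚ.+-identityʳ 1ℚ))
    }

  accretive-× : ∀ w {s} → Accretive s → Accretive (w ⨯ s)
  accretive-× zero    S = projection-accretive 0-isProjection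
  accretive-× (suc w) S = accretive-+ S (accretive-× w S)

  accretive-sum : ∀ {n} {s : Fin n → Carrier} → (∀ k → Accretive (s k)) → Accretive (sum s)
  accretive-sum {zero}  S = projection-accretive 0-isProjection
  accretive-sum {suc n} S = accretive-+ (S zero) (accretive-sum (λ k → S (suc k)))

  -- Compressing M − s by p gives (M + 1) p, whose norm is at most M ‖ p ‖.
  accretive-compression : ∀ {p s} → IsProjection p → Accretive s →
    p + p * (s * p) ≈ 0# → p ≈ 0#
  accretive-compression {p} {s} proj S p+psp≈0 = ‖‖-definite p
    (shrinking-idempotent-≃0 bound {‖ p ‖} {‖ fromℕℂ (suc bound) · p ‖}
      (0⊑‖‖ p) (0⊑‖‖ _) (‖projection‖² proj)
      (‖‖-homogeneous (fromℕℂ (suc bound)) p) norm-bound)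
    where
    open Accretive S
    corner : fromℕℂ (suc bound) · p ≈ p * (rest * p)
    corner = begin
      fromℕℂ (suc bound) · p                  ≈⟨ fromℕℂ-· (suc bound) p ⟩
      p + bound ⨯ p                           ≈⟨ +-congˡ (×-congʳ bound (trans (idempotent proj)
                                                   (*-congˡ (sym (*-identityˡ p))))) ⟩
      p + bound ⨯ (p * (1# * p))              ≈⟨ +-congˡ (trans (sym (×-comm-* bound p (1# * p)))
                                                   (*-congˡ (sym (×-assoc-* bound 1# p)))) ⟩
      p + p * (bound ⨯ 1# * p)                ≈⟨ +-congˡ (*-congˡ (*-congʳ rest+s)) ⟨
      p + p * ((rest + s) * p)                ≈⟨ +-congˡ (trans (*-congˡ (distribʳ p rest s))
                                                   (distribˡ p (rest * p) (s * p))) ⟩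
      p + (p * (rest * p) + p * (s * p))      ≈⟨ +-congˡ (+-comm _ _) ⟩
      p + (p * (s * p) + p * (rest * p))      ≈⟨ +-assoc p _ _ ⟨
      (p + p * (s * p)) + p * (rest * p)      ≈⟨ +-congʳ p+psp≈0 ⟩
      0# + p * (rest * p)                     ≈⟨ +-identityˡ _ ⟩
      p * (rest * p)                          ∎

    α = ‖ p ‖
    m = fromℕℝ bound
    norm-bound : ‖ fromℕℂ (suc bound) · p ‖ ⊑ m *ℝ α
    -- Submultiplicativity gives ‖p‖ · M · ‖p‖, and ‖p‖² = ‖p‖ absorbs one factor.
    norm-bound = ⊑-trans (≃ℝ⇒⊑ _ _ (‖‖-cong corner))
      (⊑-trans (‖‖-*-⊑ p (rest * p))
      (⊑-trans (*ℝ-monoʳ-⊑ (0⊑‖‖ p)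
        (⊑-trans (‖‖-*-⊑ rest p) (*ℝ-monoˡ-⊑ (0⊑‖‖ p) ‖rest‖⊑)))
      (⊑-trans (*ℝ-comm-⊑ α (m *ℝ α))
      (⊑-trans (⊑-pointwise-≡ λ n → ℚ.*-assoc (seq m n) (seq α n) (seq α n))
        (*ℝ-monoʳ-⊑ (⊑-pointwise λ _ → 0≤fromℕℚ bound) (≃ℝ⇒⊑ (α *ℝ α) α (‖projection‖² proj)))))))

  -- For p = q_k with weight above W, split the total as W 1 = (W + 1) p + s, where s is accretive.
  -- Multiplying by p on both sides gives W p = (W + 1) p + p s p, so p + p s p = 0 and
  -- `accretive-compression` applies.
  heavy-projection-vanishes : ∀ {n} (w : Fin n → ℕ) (q : Fin n → Carrier) →
    (∀ k → IsProjection (q k)) → ∀ W → sum (λ k → w k ⨯ q k) ≈ W ⨯ 1# →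
    ∀ k → W ℕ.< w k → q k ≈ 0#
  heavy-projection-vanishes {suc n} w q proj W total k W<w =
    accretive-compression (proj k) accretive (+-cancelˡ (W ⨯ p) _ _ (begin
      W ⨯ p + (p + p * (s * p))           ≈⟨ +-assoc (W ⨯ p) p _ ⟨
      (W ⨯ p + p) + p * (s * p)           ≈⟨ +-congʳ (+-comm (W ⨯ p) p) ⟩
      suc W ⨯ p + p * (s * p)             ≈⟨ +-congʳ (×-congʳ (suc W) ppp) ⟨
      suc W ⨯ (p * (p * p)) + p * (s * p) ≈⟨ +-congʳ (trans (sym (×-comm-* (suc W) p (p * p)))
                                                (*-congˡ (sym (×-assoc-* (suc W) p p)))) ⟩
      p * (suc W ⨯ p * p) + p * (s * p)   ≈⟨ distribˡ p (suc W ⨯ p * p) (s * p) ⟨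
      p * (suc W ⨯ p * p + s * p)         ≈⟨ *-congˡ (distribʳ p (suc W ⨯ p) s) ⟨
      p * ((suc W ⨯ p + s) * p)           ≈⟨ *-congˡ (*-congʳ split) ⟩
      p * (W ⨯ 1# * p)                    ≈⟨ *-congˡ (trans (×-assoc-* W 1# p) (×-congʳ W (*-identityˡ p))) ⟩
      p * (W ⨯ p)                         ≈⟨ ×-comm-* W p p ⟩
      W ⨯ (p * p)                         ≈⟨ ×-congʳ W (idempotent (proj k)) ⟨
      W ⨯ p                               ≈⟨ +-identityʳ (W ⨯ p) ⟨
      W ⨯ p + 0#                          ∎))
    where
    p = q k
    term = λ j → w j ⨯ q j
    -- The weight of p beyond W + 1; the truncated subtraction is exact because W < w_k.
    d = w k ℕ.∸ suc W
    s = d ⨯ p + sum (removeAt term k)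
    accretive : Accretive s
    accretive = accretive-+ (accretive-× d (projection-accretive (proj k)))
      (accretive-sum {s = removeAt term k}
        (λ j → accretive-× (w (punchIn k j)) (projection-accretive (proj (punchIn k j)))))
    ppp : p * (p * p) ≈ p
    ppp = trans (*-congˡ (sym (idempotent (proj k)))) (sym (idempotent (proj k)))
    split : suc W ⨯ p + s ≈ W ⨯ 1#
    split = begin
      suc W ⨯ p + (d ⨯ p + sum (removeAt term k))  ≈⟨ +-assoc _ _ _ ⟨
      (suc W ⨯ p + d ⨯ p) + sum (removeAt term k)  ≈⟨ +-congʳ (×-homo-+ p (suc W) d) ⟨
      (suc W ℕ.+ d) ⨯ p + sum (removeAt term k)    ≈⟨ +-congʳ (×-congˡ (ℕ.m+[n∸m]≡n W<w)) ⟩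
      w k ⨯ p + sum (removeAt term k)              ≈⟨ sum-remove {i = k} term ⟨
      sum term                                     ≈⟨ total ⟩
      W ⨯ 1#                                       ∎

-- Quantum permutation matrices and switching

module Switching {c ℓ} (𝓐 : UnitalCStarAlgebra c ℓ) where
  open UnitalCStarAlgebra 𝓐
  open Ring ring using (setoid; semiring; refl; sym; trans; reflexive; +-cong; +-congʳ; +-identityˡ;
    +-identityʳ; *-congˡ; *-congʳ; *-assoc; *-identityˡ; *-identityʳ; zeroˡ; zeroʳ; distribˡ; distribʳ)
  open SemiringSum semiring using (sum-cong-≋; ∑-comm; ∑-distrib-+; *-distribˡ-sum; *-distribʳ-sum)
  open SemiringMult semiring renaming (_×_ to _⨯_)
  open RingProperties ring using (+-cancelˡ)
  open Projections 𝓐 using (heavy-projection-vanishes)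
  open SetoidReasoning setoid

  -- Booleans as central elements of the algebra.

  ⟦_⟧ : Bool → Carrier
  ⟦ b ⟧ = if b then 1# else 0#

  ⟦⟧-central : ∀ b x → ⟦ b ⟧ * x ≈ x * ⟦ b ⟧
  ⟦⟧-central true  x = trans (*-identityˡ x) (sym (*-identityʳ x))
  ⟦⟧-central false x = trans (zeroˡ x) (sym (zeroʳ x))

  ⟦⟧-∧ : ∀ a b → ⟦ a ∧ b ⟧ ≈ ⟦ a ⟧ * ⟦ b ⟧
  ⟦⟧-∧ true  b = sym (*-identityˡ ⟦ b ⟧)
  ⟦⟧-∧ false b = sym (zeroˡ ⟦ b ⟧)

  ⟦⟧-not : ∀ b → ⟦ b ⟧ + ⟦ not b ⟧ ≈ 1#
  ⟦⟧-not true  = +-identityʳ 1#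
  ⟦⟧-not false = +-identityˡ 1#

  -- Brings neighbour counts into the algebra, where they can be compared with sums of matrix
  -- entries.
  ∣∩∣-⨯ : ∀ {n} (f g : Fin n → Bool) →
    ∣ tabulate f ∩ tabulate g ∣ ⨯ 1# ≈ sum (λ k → ⟦ f k ⟧ * ⟦ g k ⟧)
  ∣∩∣-⨯ {zero}  f g = refl
  ∣∩∣-⨯ {suc n} f g = trans head
    (+-cong (⟦⟧-∧ (f zero) (g zero)) (∣∩∣-⨯ (λ k → f (suc k)) (λ k → g (suc k))))
    where
    rest = ∣ tabulate (λ k → f (suc k)) ∩ tabulate (λ k → g (suc k)) ∣
    head : ∣ tabulate f ∩ tabulate g ∣ ⨯ 1# ≈ ⟦ f zero ∧ g zero ⟧ + rest ⨯ 1#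
    head with f zero ∧ g zero
    ... | true  = refl
    ... | false = sym (+-identityˡ _)

  transpose : ∀ {n} → Matrix 𝓐 n → Matrix 𝓐 n
  transpose u i j = u j i

  Intertwines : ∀ {n} → Graph n → Graph n → Matrix 𝓐 n → Set ℓ
  Intertwines G₁ G₂ u = EqM 𝓐 (mul 𝓐 u (adjacency 𝓐 G₁)) (mul 𝓐 (adjacency 𝓐 G₂) u)

  -- Transposition does not respect products over a noncommutative algebra in general. Here each
  -- product has a factor 0 or 1, which is central, and adjacency matrices are symmetric.
  transpose-intertwines : ∀ {n} (G₁ G₂ : Graph n) u →
    Intertwines G₁ G₂ u → Intertwines G₂ G₁ (transpose u)
  transpose-intertwines G₁ G₂ u eq i j = begin
    sum (λ k → u k i * ⟦ adj G₂ k j ⟧)  ≈⟨ sum-cong-≋ (λ k → flip G₂ (u k i) k j) ⟩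
    sum (λ k → ⟦ adj G₂ j k ⟧ * u k i)  ≈⟨ eq j i ⟨
    sum (λ k → u j k * ⟦ adj G₁ k i ⟧)  ≈⟨ sum-cong-≋ (λ k → flip G₁ (u j k) k i) ⟩
    sum (λ k → ⟦ adj G₁ i k ⟧ * u j k)  ∎
    where
    open Graph
    flip : ∀ G x k l → x * ⟦ adj G k l ⟧ ≈ ⟦ adj G l k ⟧ * x
    flip G x k l rewrite adj-sym G k l = sym (⟦⟧-central (adj G l k) x)

  transpose-isQuantumPermutation : ∀ {n} {u : Matrix 𝓐 n} →
    IsQuantumPermutation 𝓐 u → IsQuantumPermutation 𝓐 (transpose u)
  transpose-isQuantumPermutation qp = record
    { selfAdjoint = λ i j → selfAdjoint j i
    ; idempotent  = λ i j → idempotent j i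
    ; rowSum      = columnSum
    ; columnSum   = rowSum
    }
    where open IsQuantumPermutation qp

  -- Neighbour counts and the entries of `u`.

  module _ {n k} (π : Partition n (suc k)) (G₁ G₂ : Graph n) (u : Matrix 𝓐 n)
    (qp : IsQuantumPermutation 𝓐 u) (blockDiagonal : BlockDiagonal 𝓐 π u)
    (intertwines : Intertwines G₁ G₂ u) where
    open Graph
    open IsQuantumPermutation qp

    inCell : Fin (suc k) → Fin n → Bool
    inCell i v = ⌊ cellOf π v Fin.≟ i ⌋

    -- By block diagonality only rows in the cell of b contribute to column b, so membership of a in
    -- cell i may be replaced by that of b; the column then sums to 1.
    column-in-cell : ∀ i b → sum (λ a → ⟦ inCell i a ⟧ * u a b) ≈ ⟦ inCell i b ⟧
    column-in-cell i b = begin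
      sum (λ a → ⟦ inCell i a ⟧ * u a b)  ≈⟨ sum-cong-≋ same-cell ⟩
      sum (λ a → ⟦ inCell i b ⟧ * u a b)  ≈⟨ *-distribˡ-sum ⟦ inCell i b ⟧ (λ a → u a b) ⟨
      ⟦ inCell i b ⟧ * sum (λ a → u a b)  ≈⟨ *-congˡ (columnSum b) ⟩
      ⟦ inCell i b ⟧ * 1#                 ≈⟨ *-identityʳ _ ⟩
      ⟦ inCell i b ⟧                      ∎
      where
      same-cell : ∀ a → ⟦ inCell i a ⟧ * u a b ≈ ⟦ inCell i b ⟧ * u a b
      same-cell a with cellOf π a Fin.≟ cellOf π b
      ... | yes eq rewrite eq = refl
      ... | no neq = trans (*-congˡ (blockDiagonal a b neq))
        (trans (zeroʳ _) (sym (trans (*-congˡ (blockDiagonal a b neq)) (zeroʳ _))))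

    -- Sum entry (a, b) of A₂ u = u A₁ over all a in cell i and exchange the sums. On the A₂ side
    -- u_vb is collected once for each neighbour of v in the cell; on the A₁ side `column-in-cell`
    -- removes `u`.
    weighted-column-sum : ∀ i b →
      sum (λ v → neighboursIn G₂ π v i ⨯ u v b) ≈ neighboursIn G₁ π b i ⨯ 1#
    weighted-column-sum i b = begin
      sum (λ v → neighboursIn G₂ π v i ⨯ u v b)
        ≈⟨ sum-cong-≋ expand ⟩
      sum (λ v → sum (λ a → ⟦ inCell i a ⟧ * (⟦ adj G₂ a v ⟧ * u v b)))
        ≈⟨ ∑-comm (λ v a → ⟦ inCell i a ⟧ * (⟦ adj G₂ a v ⟧ * u v b)) ⟩
      sum (λ a → sum (λ v → ⟦ inCell i a ⟧ * (⟦ adj G₂ a v ⟧ * u v b)))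
        ≈⟨ sum-cong-≋ (λ a → *-distribˡ-sum ⟦ inCell i a ⟧ (λ v → ⟦ adj G₂ a v ⟧ * u v b)) ⟨
      sum (λ a → ⟦ inCell i a ⟧ * mul 𝓐 (adjacency 𝓐 G₂) u a b)
        ≈⟨ sum-cong-≋ (λ a → *-congˡ (intertwines a b)) ⟨
      sum (λ a → ⟦ inCell i a ⟧ * mul 𝓐 u (adjacency 𝓐 G₁) a b)
        ≈⟨ sum-cong-≋ (λ a → trans (*-distribˡ-sum ⟦ inCell i a ⟧ (λ v → u a v * ⟦ adj G₁ v b ⟧))
             (sum-cong-≋ (λ v → sym (*-assoc ⟦ inCell i a ⟧ (u a v) ⟦ adj G₁ v b ⟧)))) ⟩
      sum (λ a → sum (λ v → (⟦ inCell i a ⟧ * u a v) * ⟦ adj G₁ v b ⟧))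
        ≈⟨ ∑-comm (λ a v → (⟦ inCell i a ⟧ * u a v) * ⟦ adj G₁ v b ⟧) ⟩
      sum (λ v → sum (λ a → (⟦ inCell i a ⟧ * u a v) * ⟦ adj G₁ v b ⟧))
        ≈⟨ sum-cong-≋ (λ v → *-distribʳ-sum ⟦ adj G₁ v b ⟧ (λ a → ⟦ inCell i a ⟧ * u a v)) ⟨
      sum (λ v → sum (λ a → ⟦ inCell i a ⟧ * u a v) * ⟦ adj G₁ v b ⟧)
        ≈⟨ sum-cong-≋ (λ v → *-congʳ (column-in-cell i v)) ⟩
      sum (λ v → ⟦ inCell i v ⟧ * ⟦ adj G₁ v b ⟧)
        ≈⟨ sum-cong-≋ swap ⟩
      sum (λ v → ⟦ adj G₁ b v ⟧ * ⟦ inCell i v ⟧)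
        ≈⟨ ∣∩∣-⨯ (adj G₁ b) (inCell i) ⟨
      neighboursIn G₁ π b i ⨯ 1#
        ∎
      where
      swap : ∀ v → ⟦ inCell i v ⟧ * ⟦ adj G₁ v b ⟧ ≈ ⟦ adj G₁ b v ⟧ * ⟦ inCell i v ⟧
      swap v rewrite adj-sym G₁ v b = ⟦⟧-central (inCell i v) ⟦ adj G₁ b v ⟧
      reorder : ∀ v a → ⟦ adj G₂ v a ⟧ * ⟦ inCell i a ⟧ * u v b ≈ ⟦ inCell i a ⟧ * (⟦ adj G₂ a v ⟧ * u v b)
      reorder v a rewrite adj-sym G₂ v a =
        trans (*-congʳ (⟦⟧-central (adj G₂ a v) ⟦ inCell i a ⟧)) (*-assoc _ _ _)
      expand : ∀ v → neighboursIn G₂ π v i ⨯ u v b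
        ≈ sum (λ a → ⟦ inCell i a ⟧ * (⟦ adj G₂ a v ⟧ * u v b))
      expand v = begin
        N ⨯ u v b
          ≈⟨ ×-congʳ N (*-identityˡ (u v b)) ⟨
        N ⨯ (1# * u v b)
          ≈⟨ ×-assoc-* N 1# (u v b) ⟨
        N ⨯ 1# * u v b
          ≈⟨ *-congʳ (∣∩∣-⨯ (adj G₂ v) (inCell i)) ⟩
        sum (λ a → ⟦ adj G₂ v a ⟧ * ⟦ inCell i a ⟧) * u v b
          ≈⟨ *-distribʳ-sum (u v b) (λ a → ⟦ adj G₂ v a ⟧ * ⟦ inCell i a ⟧) ⟩
        sum (λ a → ⟦ adj G₂ v a ⟧ * ⟦ inCell i a ⟧ * u v b)
          ≈⟨ sum-cong-≋ (reorder v) ⟩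
        sum (λ a → ⟦ inCell i a ⟧ * (⟦ adj G₂ a v ⟧ * u v b))
          ∎
        where N = neighboursIn G₂ π v i

    -- Column b consists of projections; weighted by the counts in G₂ they add up to the count of b
    -- in G₁, which the weight of row a exceeds.
    more-neighbours⇒≈0 : ∀ i a b → neighboursIn G₁ π b i ℕ.< neighboursIn G₂ π a i → u a b ≈ 0#
    more-neighbours⇒≈0 i a b = heavy-projection-vanishes
      (λ v → neighboursIn G₂ π v i) (λ v → u v b)
      (λ v → record { selfAdjoint = selfAdjoint v b ; idempotent = idempotent v b })
      (neighboursIn G₁ π b i) (weighted-column-sum i b) a

  -- Vertex types and switching.

  module _ {n k} (π : Partition n (suc k)) (G₁ G₂ : Graph n) (u : Matrix 𝓐 n)
    (qp : IsQuantumPermutation 𝓐 u) (blockDiagonal : BlockDiagonal 𝓐 π u)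
    (intertwines : Intertwines G₁ G₂ u) where
    open Graph
    open IsQuantumPermutation qp

    neighboursIn-≢⇒≈0 : ∀ i a b → neighboursIn G₂ π a i ≢ neighboursIn G₁ π b i → u a b ≈ 0#
    neighboursIn-≢⇒≈0 i a b neq with ℕ.<-cmp (neighboursIn G₂ π a i) (neighboursIn G₁ π b i)
    -- Transposing exchanges the two graphs, so the strict inequality is again in the required
    -- direction.
    ... | tri< lt _ _ = more-neighbours⇒≈0 π G₂ G₁ (transpose u)
            (transpose-isQuantumPermutation qp) (λ v w neq′ → blockDiagonal w v (λ eq → neq′ (≡.sym eq)))
            (transpose-intertwines G₁ G₂ u intertwines) i b a lt
    ... | tri≈ _ eq _ = contradiction eq neq
    ... | tri> _ _ gt = more-neighbours⇒≈0 π G₁ G₂ u qp blockDiagonal intertwines i a b gt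

    -- Rows of `u` are vertices of G₂ and columns are vertices of G₁, so `a` is read in G₂ and `b`
    -- in G₁.
    SameType : Fin n → Fin n → Set
    SameType a b = cellOf π a ≡ cellOf π b × (∀ i → neighboursIn G₂ π a i ≡ neighboursIn G₁ π b i)

    -- The case distinction is on cells and counts, which are decidable; vanishing of an entry of
    -- `u` is not assumed to be.
    ≈0-or-sameType : ∀ a b → u a b ≈ 0# ⊎ SameType a b
    ≈0-or-sameType a b with cellOf π a Fin.≟ cellOf π b
    ... | no neq = inj₁ (blockDiagonal a b neq)
    ... | yes eq with Fin.all? (λ i → neighboursIn G₂ π a i ℕ.≟ neighboursIn G₁ π b i)
    ...   | yes same = inj₂ (eq , same)
    ...   | no differ =
            let (i , neq) = Fin.¬∀⟶∃¬ _ _ (λ i → neighboursIn G₂ π a i ℕ.≟ neighboursIn G₁ π b i) differ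
            in inj₁ (neighboursIn-≢⇒≈0 i a b neq)

    -- This is `half` with its vertices replaced by the data it depends on: a cell and neighbour
    -- counts for the first, a cell for the second. It can thus be compared across the two graphs.
    halfOf : Fin (suc k) → (Fin (suc k) → ℕ) → Fin (suc k) → Bool
    halfOf c N d = ⌊ c Fin.≟ D ⌋ ∧ not ⌊ d Fin.≟ D ⌋ ∧ ⌊ 2 ℕ.* N d ℕ.≟ ∣ cell π d ∣ ⌋

    halfOf-cong : ∀ {c c′ N N′ d} → c ≡ c′ → (∀ i → N i ≡ N′ i) →
      halfOf c N d ≡ halfOf c′ N′ d
    halfOf-cong {c} {d = d} ≡.refl N≗N′ =
      cong (λ N → ⌊ c Fin.≟ D ⌋ ∧ not ⌊ d Fin.≟ D ⌋ ∧ ⌊ 2 ℕ.* N ℕ.≟ ∣ cell π d ∣ ⌋) (N≗N′ d)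

    -- The switching decision shared by all relevant terms of entry (a, b); it does not mention the
    -- summation index.
    flipped : Fin n → Fin n → Bool
    flipped a b = halfOf (cellOf π a) (neighboursIn G₂ π a) (cellOf π b)
      ∨ halfOf (cellOf π b) (neighboursIn G₁ π b) (cellOf π a)

    -- The decision for v and b in G₁ depends on v only through its type, and v has in G₁ the type
    -- that a has in G₂.
    flipped₁ : ∀ a v b → SameType a v → half G₁ π v b ∨ half G₁ π b v ≡ flipped a b
    flipped₁ a v b (eq , same) = cong₂ _∨_
      (halfOf-cong (≡.sym eq) (λ i → ≡.sym (same i)))
      (cong (halfOf (cellOf π b) (neighboursIn G₁ π b)) (≡.sym eq))

    flipped₂ : ∀ a v b → SameType v b → half G₂ π a v ∨ half G₂ π v a ≡ flipped a b
    flipped₂ a v b (eq , same) = cong₂ _∨_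
      (cong (halfOf (cellOf π a) (neighboursIn G₂ π a)) eq)
      (halfOf-cong eq same)

    flipIf : Bool → Bool → Bool
    flipIf t e = if t then not e else e

    -- When `t` is `true`, each flipped sum together with its unflipped counterpart is a full row or
    -- column sum of `u`, hence 1. The unflipped sums agree and cancel.
    intertwines-flipped : ∀ t a b →
      sum (λ v → u a v * ⟦ flipIf t (adj G₁ v b) ⟧) ≈ sum (λ v → ⟦ flipIf t (adj G₂ a v) ⟧ * u v b)
    intertwines-flipped false a b = intertwines a b
    intertwines-flipped true  a b = +-cancelˡ (mul 𝓐 u (adjacency 𝓐 G₁) a b) _ _ (begin
      mul 𝓐 u (adjacency 𝓐 G₁) a b + sum (λ v → u a v * ⟦ not (adj G₁ v b) ⟧)
        ≈⟨ ∑-distrib-+ (λ v → u a v * ⟦ adj G₁ v b ⟧) (λ v → u a v * ⟦ not (adj G₁ v b) ⟧) ⟨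
      sum (λ v → u a v * ⟦ adj G₁ v b ⟧ + u a v * ⟦ not (adj G₁ v b) ⟧)
        ≈⟨ sum-cong-≋ (λ v → trans (sym (distribˡ _ _ _))
             (trans (*-congˡ (⟦⟧-not (adj G₁ v b))) (*-identityʳ _))) ⟩
      sum (λ v → u a v)
        ≈⟨ trans (rowSum a) (sym (columnSum b)) ⟩
      sum (λ v → u v b)
        ≈⟨ sum-cong-≋ (λ v → trans (sym (distribʳ _ _ _))
             (trans (*-congʳ (⟦⟧-not (adj G₂ a v))) (*-identityˡ _))) ⟨
      sum (λ v → ⟦ adj G₂ a v ⟧ * u v b + ⟦ not (adj G₂ a v) ⟧ * u v b)
        ≈⟨ ∑-distrib-+ (λ v → ⟦ adj G₂ a v ⟧ * u v b) (λ v → ⟦ not (adj G₂ a v) ⟧ * u v b) ⟩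
      mul 𝓐 (adjacency 𝓐 G₂) u a b + sum (λ v → ⟦ not (adj G₂ a v) ⟧ * u v b)
        ≈⟨ +-congʳ (intertwines a b) ⟨
      mul 𝓐 u (adjacency 𝓐 G₁) a b + sum (λ v → ⟦ not (adj G₂ a v) ⟧ * u v b)
        ∎)

    -- Where the entry of `u` vanishes, the Boolean beside it may be changed at will; in all other
    -- terms it is flipped exactly according to `flipped a b`. Both sums thus become those of
    -- `intertwines-flipped`.
    switch-intertwines : Intertwines (switch G₁ π) (switch G₂ π) u
    switch-intertwines a b = begin
      sum (λ v → u a v * ⟦ adj (switch G₁ π) v b ⟧)
        ≈⟨ sum-cong-≋ left ⟩
      sum (λ v → u a v * ⟦ flipIf (flipped a b) (adj G₁ v b) ⟧)
        ≈⟨ intertwines-flipped (flipped a b) a b ⟩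
      sum (λ v → ⟦ flipIf (flipped a b) (adj G₂ a v) ⟧ * u v b)
        ≈⟨ sum-cong-≋ right ⟨
      sum (λ v → ⟦ adj (switch G₂ π) a v ⟧ * u v b)
        ∎
      where
      left : ∀ v → u a v * ⟦ adj (switch G₁ π) v b ⟧ ≈ u a v * ⟦ flipIf (flipped a b) (adj G₁ v b) ⟧
      left v with ≈0-or-sameType a v
      ... | inj₁ u≈0  = trans (*-congʳ u≈0) (trans (zeroˡ _) (sym (trans (*-congʳ u≈0) (zeroˡ _))))
      ... | inj₂ same = reflexive
        (cong (λ t → u a v * ⟦ flipIf t (adj G₁ v b) ⟧) (flipped₁ a v b same))
      right : ∀ v → ⟦ adj (switch G₂ π) a v ⟧ * u v b ≈ ⟦ flipIf (flipped a b) (adj G₂ a v) ⟧ * u v b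
      right v with ≈0-or-sameType v b
      ... | inj₁ u≈0  = trans (*-congˡ u≈0) (trans (zeroʳ _) (sym (trans (*-congˡ u≈0) (zeroʳ _))))
      ... | inj₂ same = reflexive
        (cong (λ t → ⟦ flipIf t (adj G₂ a v) ⟧ * u v b) (flipped₂ a v b same))

theorem4p3 : ∀ {c ℓ : Level} {n m k : ℕ} (G₁ G₂ : Graph n) (V : Partition n m)
    → (𝓐 : UnitalCStarAlgebra c ℓ) (u : Matrix 𝓐 n)
    → IsQuantumPermutation 𝓐 u
    → EqM 𝓐 (mul 𝓐 u (adjacency 𝓐 G₁)) (mul 𝓐 (adjacency 𝓐 G₂) u)
    → BlockDiagonal 𝓐 V u
    → (S : Partition m (suc k))
    → GodsilMcKay G₁ (mergeCells V S)
    → GodsilMcKay G₂ (mergeCells V S)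
    → QuantumIsomorphic c ℓ (switch G₁ (mergeCells V S)) (switch G₂ (mergeCells V S))
theorem4p3 G₁ G₂ V 𝓐 u qp intertwines blockDiagonal S _ _ =
  -- `QuantumIsomorphic` wants the first graph's matrix on the left of the intertwiner, whereas in
  -- the relation for `u` it stands on the right; transposing moves it across.
  𝓐 , transpose u , transpose-isQuantumPermutation qp ,
  λ i j → Ring.sym (UnitalCStarAlgebra.ring 𝓐)
    (transpose-intertwines (switch G₁ π) (switch G₂ π) u
      (switch-intertwines π G₁ G₂ u qp
        -- Vertices in different merged cells lie in different parts of `V`, so `u` is block
        -- diagonal for the coarser partition too.
        (λ a b neq → blockDiagonal a b (λ eq → neq (cong (cellOf S) eq))) intertwines) i j)
  where
  open Switching 𝓐
  π = mergeCells V S
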